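{- Let $(P,r)$ be a finite graded poset of rank $n$ with Möbius function $\mu$, and suppose that the magnitude homology of $P$ is diagonal. Then for every $0\le k\le n$ there are isomorphisms $$H_i(\varDelta^{(k)}(P))\cong H_i(\varDelta(P))\qquad (0\le i\le k-1),$$ and the rank of the top homology group satisfies $$\operatorname{rk} H_k(\varDelta^{(k)}(P))\le \sum_{\substack{x\le y\\ r(y)-r(x)=k}}|\mu(x,y)|.$$
   Context: All homology is with integer coefficients. A finite poset $P$ is graded of rank $n\ge 0$ if every maximal chain of $P$ has length $n$ (i.e. $n+1$ elements); its rank function $r:P\to\{0,\dots,n\}$ satisfies $r(x)=0$ for $x$ minimal and $r(y)=r(x)+1$ if $y$ covers $x$. The order complex $\varDelta(P)$ is the abstract simplicial complex whose simplices are the chains of $P$. For $0\le k\le n$ let $\varDelta^{(k)}(P)=\{(x_0<\cdots<x_l)\mid r(x_l)-r(x_0)\le k\}$, a subcomplex of $\varDelta(P)$. Möbius function: $\mu(x,x)=1$, $\mu(x,y)=-\sum_{x\le z<y}\mu(x,z)$ for $x<y$, and $\mu(x,y)=0$ otherwise. Magnitude homology of $(P,r)$: set $d(x,y)=r(y)-r(x)$ if $x\le y$ and $d(x,y)=\infty$ otherwise, and $L(x_0,\dots,x_m)=\sum_{i=0}^{m-1}d(x_i,x_{i+1})$. Let $\mathrm{MC}^k_m(P)$ be the free abelian group on tuples $(x_0,\dots,x_m)\in P^{m+1}$ with $x_i\ne x_{i+1}$ for all $i$ and $L(x_0,\dots,x_m)=k$. The boundary $\partial:\mathrm{MC}^k_m(P)\to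 \mathrm{MC}^k_{m-1}(P)$ is $\partial=\sum_{i=0}^m(-1)^i\partial_i$, where $\partial_i$ deletes $x_i$ if the resulting tuple still has length $k$ and is $0$ otherwise. Then $\mathrm{MH}^k_m(P)=H_m(\mathrm{MC}^k_*(P),\partial)$. The magnitude homology of $P$ is diagonal if $\mathrm{MH}^k_m(P)=0$ whenever $m\ne k$. -}

module Defs where

open import Algebra.Bundles using (AbelianGroup)
open import Algebra.Morphism.Structures using (module GroupMorphisms)
import Algebra.Properties.CommutativeMonoid.Sum as MonoidSum
import Algebra.Properties.Monoid.Mult as MonoidMult
open import Data.Bool.Base using (if_then_else_; true; false)
open import Data.Fin.Base using (Fin; zero; suc; fromℕ; punchIn; toℕ)
import Data.Fin.Induction as FinInduction
import Data.Fin.Properties as Fin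
open import Data.Integer.Base as ℤ using (ℤ; +_; -[1+_]; 0ℤ; 1ℤ; -1ℤ)
import Data.Integer.Properties as ℤ
open import Data.Integer.Tactic.RingSolver using (solve-∀)
import Data.Irrelevant as Irrelevant
open import Data.List.Base as List
  using (List; []; _∷_; _++_; allFin; cartesianProduct; concatMap; filter; length; tabulate)
import Data.List.Properties as List
open import Data.List.Relation.Binary.Subset.Propositional using (_⊆_)
import Data.List.Relation.Unary.Linked as ListLinked
open import Data.Maybe.Base using (Maybe; just; nothing; zipWith)
import Data.Maybe.Properties as Maybe
open import Data.Nat.Base as ℕ using (ℕ; zero; suc)
import Data.Nat.Properties as ℕ
open import Data.Product.Base using (_×_; _,_; ∃-syntax; proj₁; proj₂)
open import Data.Refinement using (Refinement; Refinement-syntax; _,_; value; value-injective)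
open import Data.Unit.Base using (⊤; tt)
open import Data.Vec.Base using (Vec; []; _∷_; lookup; removeAt)
import Data.Vec.Properties as Vec
open import Data.Vec.Relation.Unary.Linked using (Linked; []; [-]; _∷_)
import Data.Vec.Relation.Unary.Linked as Linked
import Data.Vec.Relation.Unary.Linked.Properties as Linked
open import Function.Base using (flip; _on_)
open import Function.Bundles using (_↔_; Inverse)
open import Induction.WellFounded using (Acc; acc; WellFounded; module Subrelation)
open import Level using (0ℓ)
import Relation.Binary.Construct.NonStrictToStrict as ToStrict
import Relation.Binary.Construct.On as On
open import Relation.Binary.Core using (Rel)
open import Relation.Binary.Definitions using (Decidable; DecidableEquality; Transitive)
open import Relation.Binary.PropositionalEquality
  using (_≡_; _≢_; refl; sym; trans; cong; cong₂; subst; subst₂; isEquivalence; module ≡-Reasoning)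
open import Relation.Binary.Structures using (IsDecPartialOrder; IsStrictPartialOrder)
open import Relation.Nullary.Decidable using (Dec; does; yes; no; map′; _×-dec_)
open import Relation.Nullary.Negation using (¬_)

module _ (A : AbelianGroup 0ℓ 0ℓ) where
  open AbelianGroup A

  Trivial : Set
  Trivial = ∀ x → x ≈ ε

  infixr 8 _·_

  _·_ : ℤ → Carrier → Carrier
  (+ n)    · x = MonoidMult._×_ monoid n x
  -[1+ n ] · x = (MonoidMult._×_ monoid (suc n) x) ⁻¹

  LinearlyIndependent : ∀ {s} → (Fin s → Carrier) → Set
  LinearlyIndependent {s} v =
    ∀ (a : Fin s → ℤ) → MonoidSum.sum commutativeMonoid (λ i → a i · v i) ≈ ε → ∀ i → a i ≡ 0ℤ

  -- The rank is the largest size of a ℤ-linearly independent family.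
  HasRank : ℕ → Set
  HasRank ρ = (∃[ v ] LinearlyIndependent {ρ} v)
            × (∀ {s} (v : Fin s → Carrier) → LinearlyIndependent v → s ℕ.≤ ρ)

infix 4 _≅_

_≅_ : AbelianGroup 0ℓ 0ℓ → AbelianGroup 0ℓ 0ℓ → Set
A ≅ B = ∃[ f ] IsGroupIsomorphism f
  where open GroupMorphisms (AbelianGroup.rawGroup A) (AbelianGroup.rawGroup B)

-- The free abelian group on B: formal sums, equal when all coefficients agree (_≈_ below).
FormalSum : Set → Set
FormalSum B = List (ℤ × B)

gen : ∀ {B} → B → FormalSum B
gen b = (1ℤ , b) ∷ []

scale : ∀ {B} → ℤ → FormalSum B → FormalSum B
scale k = List.map λ (a , b) → k ℤ.* a , b

negate : ∀ {B} → FormalSum B → FormalSum B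
negate = scale -1ℤ

linear : ∀ {B C} → (B → FormalSum C) → FormalSum B → FormalSum C
linear g = concatMap λ (a , b) → scale a (g b)

module Coefficients {B : Set} (_≟_ : DecidableEquality B) where

  coef : FormalSum B → B → ℤ
  coef []             b = 0ℤ
  coef ((a , b′) ∷ c) b = (if does (b′ ≟ b) then a else 0ℤ) ℤ.+ coef c b

  infix 4 _≈_

  _≈_ : Rel (FormalSum B) 0ℓ
  c ≈ c′ = ∀ b → coef c b ≡ coef c′ b

  coef-++ : ∀ c c′ b → coef (c ++ c′) b ≡ coef c b ℤ.+ coef c′ b
  coef-++ []      c′ b = sym (ℤ.+-identityˡ _)
  coef-++ ((a , b′) ∷ c) c′ b =
    trans (cong (ℤ._+_ u) (coef-++ c c′ b)) (sym (ℤ.+-assoc u (coef c b) (coef c′ b)))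
    where u = if does (b′ ≟ b) then a else 0ℤ

  coef-scale : ∀ k c b → coef (scale k c) b ≡ k ℤ.* coef c b
  coef-scale k []             b = sym (ℤ.*-zeroʳ k)
  coef-scale k ((a , b′) ∷ c) b rewrite coef-scale k c b with does (b′ ≟ b)
  ... | true  = sym (ℤ.*-distribˡ-+ k a (coef c b))
  ... | false = lemma k (coef c b)
    where
    lemma : ∀ k x → 0ℤ ℤ.+ k ℤ.* x ≡ k ℤ.* (0ℤ ℤ.+ x)
    lemma = solve-∀

  coef-negate : ∀ c b → coef (negate c) b ≡ ℤ.- coef c b
  coef-negate c b = trans (coef-scale -1ℤ c b) (ℤ.-1*i≡-i (coef c b))

  module _ {A : Set} (g : A → FormalSum B) where

    coef-linear-++ : ∀ c c′ b →
      coef (linear g (c ++ c′)) b ≡ coef (linear g c) b ℤ.+ coef (linear g c′) b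
    coef-linear-++ c c′ b =
      trans (cong (flip coef b) (List.concatMap-++ _ c c′)) (coef-++ (linear g c) (linear g c′) b)

    coef-linear-negate : ∀ c b → coef (linear g (negate c)) b ≡ ℤ.- coef (linear g c) b
    coef-linear-negate []             b = refl
    coef-linear-negate ((a , x) ∷ c) b = begin
      coef (scale (-1ℤ ℤ.* a) (g x) ++ linear g (negate c)) b
        ≡⟨ coef-++ (scale (-1ℤ ℤ.* a) (g x)) _ b ⟩
      coef (scale (-1ℤ ℤ.* a) (g x)) b ℤ.+ coef (linear g (negate c)) b
        ≡⟨ cong₂ ℤ._+_ (coef-scale (-1ℤ ℤ.* a) (g x) b) (coef-linear-negate c b) ⟩
      -1ℤ ℤ.* a ℤ.* coef (g x) b ℤ.+ ℤ.- coef (linear g c) b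
        ≡⟨ lemma a (coef (g x) b) (coef (linear g c) b) ⟩
      ℤ.- (a ℤ.* coef (g x) b ℤ.+ coef (linear g c) b)
        ≡⟨ cong (λ u → ℤ.- (u ℤ.+ _)) (coef-scale a (g x) b) ⟨
      ℤ.- (coef (scale a (g x)) b ℤ.+ coef (linear g c) b)
        ≡⟨ cong ℤ.-_ (coef-++ (scale a (g x)) _ b) ⟨
      ℤ.- coef (scale a (g x) ++ linear g c) b ∎
      where
      open ≡-Reasoning
      lemma : ∀ a u v → -1ℤ ℤ.* a ℤ.* u ℤ.+ ℤ.- v ≡ ℤ.- (a ℤ.* u ℤ.+ v)
      lemma = solve-∀

record FreeComplex : Set₁ where
  field
    Gen  : ℕ → Set
    _≟_  : ∀ {m} → DecidableEquality (Gen m)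
    ∂gen : ∀ {m} → Gen (suc m) → FormalSum (Gen m)

  module _ {m : ℕ} where
    open Coefficients (_≟_ {m}) public

  ∂ : ∀ {m} → FormalSum (Gen (suc m)) → FormalSum (Gen m)
  ∂ = linear ∂gen

  IsCycle : ∀ {m} → FormalSum (Gen m) → Set
  IsCycle {zero}  c = ⊤
  IsCycle {suc m} c = ∂ c ≈ []

  record Cycle (m : ℕ) : Set where
    eta-equality
    constructor cycle
    field
      chain   : FormalSum (Gen m)
      isCycle : IsCycle chain
  open Cycle public

  infix 4 _∼_

  _∼_ : ∀ {m} → Rel (Cycle m) 0ℓ
  z ∼ z′ = ∃[ b ] ∂ b ≈ chain z ++ negate (chain z′)

  isCycle-++ : ∀ {m} (c c′ : FormalSum (Gen m)) → IsCycle c → IsCycle c′ → IsCycle (c ++ c′)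
  isCycle-++ {zero}  c c′ p q   = tt
  isCycle-++ {suc m} c c′ p q b =
    trans (coef-linear-++ ∂gen c c′ b) (cong₂ ℤ._+_ (p b) (q b))

  isCycle-negate : ∀ {m} (c : FormalSum (Gen m)) → IsCycle c → IsCycle (negate c)
  isCycle-negate {zero}  c p   = tt
  isCycle-negate {suc m} c p b = trans (coef-linear-negate ∂gen c b) (cong ℤ.-_ (p b))

  isCycle-[] : ∀ {m} → IsCycle {m} []
  isCycle-[] {zero}  = tt
  isCycle-[] {suc m} = λ _ → refl

  coef-diff : ∀ {m} (c c′ : FormalSum (Gen m)) b →
              coef (c ++ negate c′) b ≡ coef c b ℤ.- coef c′ b
  coef-diff c c′ b = trans (coef-++ c (negate c′) b) (cong (ℤ._+_ (coef c b)) (coef-negate c′ b))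

  ≈⇒∼ : ∀ {m} (z z′ : Cycle m) → chain z ≈ chain z′ → z ∼ z′
  ≈⇒∼ z z′ eq = [] , λ b → sym (trans (coef-diff (chain z) (chain z′) b)
                                        (ℤ.i≡j⇒i-j≡0 (eq b)))

  infixl 6 _+ᶻ_

  _+ᶻ_ : ∀ {m} → Cycle m → Cycle m → Cycle m
  cycle c p +ᶻ cycle c′ q = cycle (c ++ c′) (isCycle-++ c c′ p q)

  -ᶻ_ : ∀ {m} → Cycle m → Cycle m
  -ᶻ cycle c p = cycle (negate c) (isCycle-negate c p)

  0ᶻ : ∀ {m} → Cycle m
  0ᶻ = cycle [] isCycle-[]

  private
    ∼-sym : ∀ {m} {x y : Cycle m} → x ∼ y → y ∼ x
    ∼-sym {m} {cycle x _} {cycle y _} (e , p) = negate e , λ b → begin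
      coef (∂ (negate e)) b        ≡⟨ coef-linear-negate ∂gen e b ⟩
      ℤ.- coef (∂ e) b             ≡⟨ cong ℤ.-_ (trans (p b) (coef-diff x y b)) ⟩
      ℤ.- (coef x b ℤ.- coef y b)  ≡⟨ lemma (coef x b) (coef y b) ⟩
      coef y b ℤ.- coef x b        ≡⟨ coef-diff y x b ⟨
      coef (y ++ negate x) b       ∎
      where
      open ≡-Reasoning
      lemma : ∀ u v → ℤ.- (u ℤ.- v) ≡ v ℤ.- u
      lemma = solve-∀

    ∼-trans : ∀ {m} {x y z : Cycle m} → x ∼ y → y ∼ z → x ∼ z
    ∼-trans {m} {cycle x _} {cycle y _} {cycle z _} (e , p) (f , q) = e ++ f , λ b → begin
      coef (∂ (e ++ f)) b
        ≡⟨ coef-linear-++ ∂gen e f b ⟩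
      coef (∂ e) b ℤ.+ coef (∂ f) b
        ≡⟨ cong₂ ℤ._+_ (trans (p b) (coef-diff x y b)) (trans (q b) (coef-diff y z b)) ⟩
      (coef x b ℤ.- coef y b) ℤ.+ (coef y b ℤ.- coef z b)
        ≡⟨ lemma (coef x b) (coef y b) (coef z b) ⟩
      coef x b ℤ.- coef z b
        ≡⟨ coef-diff x z b ⟨
      coef (x ++ negate z) b ∎
      where
      open ≡-Reasoning
      lemma : ∀ u v w → (u ℤ.- v) ℤ.+ (v ℤ.- w) ≡ u ℤ.- w
      lemma = solve-∀

    +ᶻ-cong : ∀ {m} {x y u v : Cycle m} → x ∼ y → u ∼ v → x +ᶻ u ∼ y +ᶻ v
    +ᶻ-cong {m} {cycle x _} {cycle y _} {cycle u _} {cycle v _} (e , p) (f , q) =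
      e ++ f , λ b → begin
      coef (∂ (e ++ f)) b
        ≡⟨ coef-linear-++ ∂gen e f b ⟩
      coef (∂ e) b ℤ.+ coef (∂ f) b
        ≡⟨ cong₂ ℤ._+_ (trans (p b) (coef-diff x y b)) (trans (q b) (coef-diff u v b)) ⟩
      (coef x b ℤ.- coef y b) ℤ.+ (coef u b ℤ.- coef v b)
        ≡⟨ lemma (coef x b) (coef y b) (coef u b) (coef v b) ⟩
      (coef x b ℤ.+ coef u b) ℤ.- (coef y b ℤ.+ coef v b)
        ≡⟨ cong₂ ℤ._-_ (coef-++ x u b) (coef-++ y v b) ⟨
      coef (x ++ u) b ℤ.- coef (y ++ v) b
        ≡⟨ coef-diff (x ++ u) (y ++ v) b ⟨
      coef ((x ++ u) ++ negate (y ++ v)) b ∎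
      where
      open ≡-Reasoning
      lemma : ∀ x y u v → (x ℤ.- y) ℤ.+ (u ℤ.- v) ≡ (x ℤ.+ u) ℤ.- (y ℤ.+ v)
      lemma = solve-∀

    -ᶻ-cong : ∀ {m} {x y : Cycle m} → x ∼ y → -ᶻ x ∼ -ᶻ y
    -ᶻ-cong {m} {cycle x _} {cycle y _} (e , p) = negate e , λ b → begin
      coef (∂ (negate e)) b                   ≡⟨ coef-linear-negate ∂gen e b ⟩
      ℤ.- coef (∂ e) b                        ≡⟨ cong ℤ.-_ (trans (p b) (coef-diff x y b)) ⟩
      ℤ.- (coef x b ℤ.- coef y b)             ≡⟨ ℤ.neg-distrib-+ (coef x b) _ ⟩
      ℤ.- coef x b ℤ.- ℤ.- coef y b           ≡⟨ cong₂ ℤ._-_ (coef-negate x b) (coef-negate y b) ⟨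
      coef (negate x) b ℤ.- coef (negate y) b ≡⟨ coef-diff (negate x) (negate y) b ⟨
      coef (negate x ++ negate (negate y)) b  ∎
      where open ≡-Reasoning

    +ᶻ-comm : ∀ {m} (x y : Cycle m) → x +ᶻ y ∼ y +ᶻ x
    +ᶻ-comm x y = ≈⇒∼ (x +ᶻ y) (y +ᶻ x) λ b → begin
      coef (chain x ++ chain y) b            ≡⟨ coef-++ (chain x) (chain y) b ⟩
      coef (chain x) b ℤ.+ coef (chain y) b  ≡⟨ ℤ.+-comm (coef (chain x) b) _ ⟩
      coef (chain y) b ℤ.+ coef (chain x) b  ≡⟨ coef-++ (chain y) (chain x) b ⟨
      coef (chain y ++ chain x) b            ∎
      where open ≡-Reasoning

    -ᶻ-inverseʳ : ∀ {m} (x : Cycle m) → x +ᶻ (-ᶻ x) ∼ 0ᶻ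
    -ᶻ-inverseʳ x = ≈⇒∼ (x +ᶻ (-ᶻ x)) 0ᶻ λ b →
      trans (coef-diff (chain x) (chain x) b) (ℤ.+-inverseʳ (coef (chain x) b))

  -- Cycles modulo boundaries. Since _∼_ only relates cycles, the quotient can
  -- be formed without recording ∂ ∘ ∂ = 0.
  H : ℕ → AbelianGroup 0ℓ 0ℓ
  H m = record
    { Carrier = Cycle m
    ; _≈_     = _∼_
    ; _∙_     = _+ᶻ_
    ; ε       = 0ᶻ
    ; _⁻¹     = -ᶻ_
    ; isAbelianGroup = record
      { isGroup = record
        { isMonoid = record
          { isSemigroup = record
            { isMagma = record
              { isEquivalence = record
                { refl  = λ {x} → ≈⇒∼ x x λ _ → refl
                ; sym   = λ {x} {y} → ∼-sym {x = x} {y}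
                ; trans = λ {x} {y} {z} → ∼-trans {x = x} {y} {z}
                }
              ; ∙-cong = λ {x} {y} {u} {v} → +ᶻ-cong {x = x} {y} {u} {v}
              }
            ; assoc = λ x y z → ≈⇒∼ ((x +ᶻ y) +ᶻ z) (x +ᶻ (y +ᶻ z)) λ b →
                cong (flip coef b) (List.++-assoc (chain x) (chain y) (chain z))
            }
          ; identity = (λ x → ≈⇒∼ (0ᶻ +ᶻ x) x λ _ → refl)
                     , (λ x → ≈⇒∼ (x +ᶻ 0ᶻ) x λ b →
                         cong (flip coef b) (List.++-identityʳ (chain x)))
          }
        ; inverse = (λ x → ∼-trans {x = (-ᶻ x) +ᶻ x} {x +ᶻ (-ᶻ x)} {0ᶻ}
                             (+ᶻ-comm (-ᶻ x) x) (-ᶻ-inverseʳ x))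
                  , -ᶻ-inverseʳ
        ; ⁻¹-cong = λ {x} {y} → -ᶻ-cong {x = x} {y}
        }
      ; comm = +ᶻ-comm
      }
    }

sign : ∀ {n} → Fin n → ℤ
sign i = -1ℤ ℤ.^ toℕ i

alternatingSum : ∀ {n B} → (Fin n → FormalSum B) → FormalSum B
alternatingSum {n} f = concatMap (λ i → scale (sign i) (f i)) (allFin n)

≟-refinement : ∀ {A : Set} {Q : A → Set} → DecidableEquality A → DecidableEquality (Refinement A Q)
≟-refinement _≟_ s t = map′ value-injective (cong value) (value s ≟ value t)

-- A simplicial complex whose simplices are recorded once each, as tuples
-- of vertices in a preferred order that is inherited by faces.
record OrderedComplex (A : Set) : Set₁ where
  field
    IsSimplex   : ∀ {m} → Vec A (suc m) → Set
    face-closed : ∀ {m} {t : Vec A (suc (suc m))} → IsSimplex t → ∀ i → IsSimplex (removeAt t i)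

simplicialChains : ∀ {A} → DecidableEquality A → OrderedComplex A → FreeComplex
simplicialChains {A} _≟_ K = record
  { Gen  = λ m → [ t ∈ Vec A (suc m) ∣ IsSimplex t ]
  ; _≟_  = ≟-refinement (Vec.≡-dec _≟_)
  ; ∂gen = λ (t , σ) → alternatingSum λ i →
             gen (removeAt t i , Irrelevant.map (λ s → face-closed s i) σ)
  }
  where open OrderedComplex K

removeAt-linked : ∀ {A : Set} {R : Rel A 0ℓ} {m} → Transitive R →
                  {t : Vec A (suc m)} → Linked R t → ∀ i → Linked R (removeAt t i)
removeAt-linked tr [-]               zero          = []
removeAt-linked tr (_ ∷ l)           zero          = l
removeAt-linked tr (_ ∷ [-])         (suc zero)    = [-]
removeAt-linked tr (p ∷ (q ∷ l))     (suc zero)    = tr p q ∷ l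
removeAt-linked tr {_ ∷ _ ∷ _ ∷ _} (p ∷ l) (suc (suc i)) = p ∷ removeAt-linked tr l (suc i)

removeAt-punchIn : ∀ {A : Set} {m} (t : Vec A (suc m)) i j →
                   lookup (removeAt t i) j ≡ lookup t (punchIn i j)
removeAt-punchIn (x ∷ t)     zero    j       = refl
removeAt-punchIn (x ∷ y ∷ t) (suc i) zero    = refl
removeAt-punchIn (x ∷ y ∷ t) (suc i) (suc j) = removeAt-punchIn (y ∷ t) i j

record FinitePoset : Set₁ where
  infix 4 _≤_ _<_ _<?_ _⋖_
  field
    Carrier           : Set
    _≤_               : Rel Carrier 0ℓ
    isDecPartialOrder : IsDecPartialOrder _≡_ _≤_
    size              : ℕ
    enumeration       : Carrier ↔ Fin size

  open IsDecPartialOrder isDecPartialOrder public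
    using (_≟_; _≤?_; isPartialOrder; antisym)
    renaming (refl to ≤-refl; trans to ≤-trans)

  elements : List Carrier
  elements = tabulate (Inverse.from enumeration)

  _<_ : Rel Carrier 0ℓ
  _<_ = ToStrict._<_ _≡_ _≤_

  _<?_ : Decidable _<_
  _<?_ = ToStrict.<-decidable _≡_ _≤_ _≟_ _≤?_

  <-trans : Transitive _<_
  <-trans = ToStrict.<-trans _≡_ _≤_ isPartialOrder

  _⋖_ : Rel Carrier 0ℓ
  x ⋖ y = x < y × (∀ z → ¬ (x < z × z < y))

  Minimal : Carrier → Set
  Minimal x = ∀ y → ¬ y < x

  IsChain : List Carrier → Set
  IsChain = ListLinked.Linked _<_

  IsMaximalChain : List Carrier → Set
  IsMaximalChain xs = IsChain xs × (∀ {ys} → IsChain ys → xs ⊆ ys → ys ⊆ xs)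

  private
    open Inverse enumeration using (to; from; strictlyInverseʳ)

    _⊏_ : Rel (Fin size) 0ℓ
    _⊏_ = _<_ on from

    ⊏-isStrictPartialOrder : IsStrictPartialOrder _≡_ _⊏_
    ⊏-isStrictPartialOrder = record
      { isEquivalence = isEquivalence
      ; irrefl        = λ { refl (_ , x≢x) → x≢x refl }
      ; trans         = <-trans
      ; <-resp-≈      = (λ { refl p → p }) , (λ { refl p → p })
      }

    lift-< : ∀ {x y} → x < y → to x ⊏ to y
    lift-< {x} {y} = subst₂ _<_ (sym (strictlyInverseʳ x)) (sym (strictlyInverseʳ y))

  <-wellFounded : WellFounded _<_
  <-wellFounded = Subrelation.wellFounded lift-<
    (On.wellFounded to (FinInduction.spo-wellFounded ⊏-isStrictPartialOrder))

  >-wellFounded : WellFounded (flip _<_)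
  >-wellFounded = Subrelation.wellFounded lift-<
    (On.wellFounded to (FinInduction.spo-noetherian ⊏-isStrictPartialOrder))

  between? : ∀ x y → Dec (∃[ z ] (x < z × z < y))
  between? x y = map′
    (λ (i , p) → from i , p)
    (λ (z , p , q) → to z , subst (x <_) (sym (strictlyInverseʳ z)) p
                          , subst (_< y) (sym (strictlyInverseʳ z)) q)
    (Fin.any? λ i → (x <? from i) ×-dec (from i <? y))

record IsMöbiusFunction (P : FinitePoset) (μ : FinitePoset.Carrier P → FinitePoset.Carrier P → ℤ) : Set where
  open FinitePoset P
  field
    μ-refl : ∀ x → μ x x ≡ 1ℤ
    μ-<    : ∀ {x y} → x < y →
             μ x y ≡ ℤ.- List.foldr ℤ._+_ 0ℤ
                           (List.map (μ x) (filter (λ z → (x ≤? z) ×-dec (z <? y)) elements))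
    μ-≰    : ∀ {x y} → ¬ x ≤ y → μ x y ≡ 0ℤ

record GradedPoset (n : ℕ) : Set₁ where
  field
    finitePoset : FinitePoset
  open FinitePoset finitePoset public
  field
    maximalChain-length : ∀ {xs} → IsMaximalChain xs → length xs ≡ suc n
    r                   : Carrier → ℕ
    r≤n                 : ∀ x → r x ℕ.≤ n
    r-minimal           : ∀ {x} → Minimal x → r x ≡ 0
    r-cover             : ∀ {x y} → x ⋖ y → r y ≡ suc (r x)

  r-mono-< : ∀ {x y} → x < y → r x ℕ.< r y
  r-mono-< {x} {y} = go (<-wellFounded y) (>-wellFounded x)
    where
    go : ∀ {x y} → Acc _<_ y → Acc (flip _<_) x → x < y → r x ℕ.< r y
    go {x} {y} (acc below) (acc above) x<y with between? x y
    ... | yes (z , x<z , z<y) = ℕ.<-trans (go (below z<y) (acc above) x<z)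
                                          (go (acc below) (above x<z) z<y)
    ... | no  ∄z              = ℕ.≤-reflexive (sym (r-cover (x<y , λ z p → ∄z (z , p))))

  r-mono-≤ : ∀ {x y} → x ≤ y → r x ℕ.≤ r y
  r-mono-≤ {x} {y} x≤y with x ≟ y
  ... | yes refl = ℕ.≤-refl
  ... | no  x≢y  = ℕ.<⇒≤ (r-mono-< (x≤y , x≢y))

  private
    head-≤ : ∀ {m} {t : Vec Carrier (suc m)} → Linked _<_ t → ∀ i → lookup t zero ≤ lookup t i
    head-≤ l zero    = ≤-refl
    head-≤ l (suc i) = proj₁ (Linked.lookup⁺ <-trans {i = zero} {suc i} l (ℕ.s≤s ℕ.z≤n))

    ≤-last : ∀ {m} {t : Vec Carrier (suc m)} → Linked _<_ t → ∀ i → lookup t i ≤ lookup t (fromℕ m)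
    ≤-last {m} l i with i Fin.≟ fromℕ m
    ... | yes refl = ≤-refl
    ... | no  i≢m  = proj₁ (Linked.lookup⁺ <-trans l (Fin.≤∧≢⇒< (Fin.≤fromℕ i) i≢m))

  -- r (x_m) - r (x_0); the truncated subtraction is exact on chains.
  rankSpan : ∀ {m} → Vec Carrier (suc m) → ℕ
  rankSpan {m} t = r (lookup t (fromℕ m)) ℕ.∸ r (lookup t zero)

  rankSpan-removeAt : ∀ {m} {t : Vec Carrier (suc (suc m))} → Linked _<_ t →
                      ∀ i → rankSpan (removeAt t i) ℕ.≤ rankSpan t
  rankSpan-removeAt {m} {t} l i
    rewrite removeAt-punchIn t i (fromℕ m) | removeAt-punchIn t i zero
    = ℕ.∸-mono (r-mono-≤ (≤-last l (punchIn i (fromℕ m)))) (r-mono-≤ (head-≤ l (punchIn i zero)))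

  Δ : OrderedComplex Carrier
  Δ = record
    { IsSimplex   = Linked _<_
    ; face-closed = removeAt-linked <-trans
    }

  Δ⟨_⟩ : ℕ → OrderedComplex Carrier
  Δ⟨ k ⟩ = record
    { IsSimplex   = λ t → Linked _<_ t × rankSpan t ℕ.≤ k
    ; face-closed = λ (l , p) i → removeAt-linked <-trans l i
                                , ℕ.≤-trans (rankSpan-removeAt l i) p
    }

  H : ℕ → OrderedComplex Carrier → AbelianGroup 0ℓ 0ℓ
  H i K = FreeComplex.H (simplicialChains _≟_ K) i

  -- The value nothing stands for the distance ∞.
  d : Carrier → Carrier → Maybe ℕ
  d x y = if does (x ≤? y) then just (r y ℕ.∸ r x) else nothing

  L : ∀ {m} → Vec Carrier (suc m) → Maybe ℕ
  L (x ∷ [])     = just 0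
  L (x ∷ y ∷ xs) = zipWith ℕ._+_ (d x y) (L (y ∷ xs))

  IsMagnitudeGenerator : ℕ → ∀ {m} → Vec Carrier (suc m) → Set
  IsMagnitudeGenerator k t = Linked _≢_ t × L t ≡ just k

  generator-increasing : ∀ {k m} {t : Vec Carrier (suc m)} → IsMagnitudeGenerator k t → Linked _<_ t
  generator-increasing {t = x ∷ []}     _               = [-]
  generator-increasing {t = x ∷ y ∷ xs} (x≢y ∷ ≢s , eq) with x ≤? y | L (y ∷ xs) in eq′
  ... | yes x≤y | just _ = (x≤y , x≢y) ∷ generator-increasing (≢s , eq′)

  generator-face : ∀ {k m} {t : Vec Carrier (suc (suc m))} → IsMagnitudeGenerator k t →
                   ∀ i → L (removeAt t i) ≡ just k → IsMagnitudeGenerator k (removeAt t i)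
  generator-face g i eq =
    Linked.map proj₂ (removeAt-linked <-trans (generator-increasing g) i) , eq

  MC : ℕ → FreeComplex
  MC k = record
    { Gen  = Generator
    ; _≟_  = ≟-refinement (Vec.≡-dec _≟_)
    ; ∂gen = λ t → alternatingSum (face t)
    }
    where
    Generator : ℕ → Set
    Generator m = [ t ∈ Vec Carrier (suc m) ∣ IsMagnitudeGenerator k t ]

    face : ∀ {m} → Generator (suc m) → Fin (suc (suc m)) → FormalSum (Generator m)
    face (t , g) i with Maybe.≡-dec ℕ._≟_ (L (removeAt t i)) (just k)
    ... | yes eq = gen (removeAt t i , Irrelevant.map (λ g′ → generator-face g′ i eq) g)
    ... | no  _  = []

  MH : ℕ → ℕ → AbelianGroup 0ℓ 0ℓ
  MH k m = FreeComplex.H (MC k) m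

  Diagonal : Set
  Diagonal = ∀ k m → m ≢ k → Trivial (MH k m)

  pairsOfSpan : ℕ → List (Carrier × Carrier)
  pairsOfSpan k = filter (λ (x , y) → (x ≤? y) ×-dec (r y ℕ.∸ r x ℕ.≟ k))
                         (cartesianProduct elements elements)

{-# OPTIONS --safe #-}
-- The magnitude complex MC j is the quotient of the chains of Δ⟨ j ⟩ by those of span below j. Given a
-- chain of degree m ≤ k whose boundary lies in Δ⟨ k ⟩, its part of maximal span j > k is therefore a cycle
-- of MC j, and m ≠ j makes it a boundary there; subtracting that boundary lowers the span. Iterating down
-- to j = k shows that the inclusion Δ⟨ k ⟩ → Δ is injective and surjective on homology below degree k.
--
-- In degree k there are no boundaries and all chains of Δ⟨ k ⟩ have span k, so H k Δ⟨ k ⟩ embeds into the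
-- k-cycles of MC k. As MC k is exact below degree k, the rank of those cycles is up to sign the Euler
-- characteristic Σₘ (-1)ᵐ rk MCₘ, where rk MCₘ counts the chains of m steps and of span k. By P. Hall's
-- theorem this is the sum of μ x y over the pairs of span k.
--
-- Ranks are handled over ℤ throughout, by fraction-free elimination.

module Submission where

open import Defs
open import Data.Integer.Base using (ℤ; ∣_∣)
open import Data.List.Base using (map)
open import Data.Nat.Base as ℕ using (ℕ)
open import Data.Nat.ListAction using (sum)
open import Data.Product.Base using (_×_; _,_; ∃-syntax)

open import Algebra.Bundles using (AbelianGroup)
import Algebra.Properties.CommutativeMonoid.Sum as MonoidSum
import Algebra.Properties.Monoid.Mult as MonoidMult
open import Algebra.Structures using (IsAbelianGroup)
open import Data.Bool.Base using (if_then_else_; true; false)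
open import Data.Fin.Base using (Fin; zero; suc; fromℕ; join; punchIn; splitAt; _↑ˡ_; _↑ʳ_)
import Data.Fin.Properties as Fin
open import Data.Integer.Base as ℤ using (0ℤ; 1ℤ; -1ℤ; -[1+_]; _+_; _*_; -_; _-_) renaming (+_ to ⁺_)
import Data.Integer.Properties as ℤ
open import Data.Integer.Tactic.RingSolver using (solve-∀)
open import Data.Irrelevant as Irrelevant using ([_])
open import Data.List.Base as List
  using (List; []; _∷_; _++_; allFin; cartesianProduct; concatMap; filter; length; tabulate)
import Data.List.Membership.DecPropositional as DecMembership
open import Data.List.Membership.Propositional using (_∈_)
open import Data.List.Membership.Propositional.Properties
  using ( ∈-cartesianProduct⁺; ∈-concatMap⁺; ∈-concatMap⁻; ∈-filter⁺; ∈-filter⁻; ∈-lookup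
        ; ∈-map⁺; ∈-map⁻; ∈-tabulate⁺)
import Data.List.Properties as List
open import Data.List.Relation.Unary.All as All using ([]; _∷_)
import Data.List.Relation.Unary.All.Properties as All
open import Data.List.Relation.Unary.AllPairs using ([]; _∷_)
import Data.List.Relation.Unary.AllPairs as AllPairs
import Data.List.Relation.Unary.AllPairs.Properties as AllPairs
open import Data.List.Relation.Unary.Any as Any using (Any; here; there)
import Data.List.Relation.Unary.Any.Properties as Any
open import Data.List.Relation.Unary.Unique.Propositional using (Unique)
import Data.List.Relation.Unary.Unique.Propositional.Properties as Unique
open import Data.Maybe.Base using (just)
import Data.Maybe.Properties as Maybe
open import Data.Nat.Base using (zero; suc; z≤n; s≤s)
import Data.Nat.Properties as ℕ
open import Data.Product.Base using (proj₁; proj₂)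
open import Data.Refinement using (Refinement; _,_; value; value-injective)
open import Data.Sum.Base using (inj₁; inj₂)
open import Data.Unit.Base using (⊤; tt)
open import Data.Vec.Base using (Vec; []; _∷_; lookup; removeAt)
open import Data.Vec.Functional as VF using (insertAt)
import Data.Vec.Functional.Properties as VF
import Data.Vec.Properties as Vec
open import Data.Vec.Relation.Unary.Linked using (Linked; [-]; []; _∷_)
import Data.Vec.Relation.Unary.Linked as Linked
open import Function.Base using (_∘_)
open import Function.Bundles using (Inverse; _↔_; mk↔ₛ′)
open import Level using (0ℓ)
open import Relation.Binary.Definitions using (DecidableEquality)
open import Relation.Binary.PropositionalEquality
  using (_≡_; _≢_; refl; sym; trans; cong; cong₂; subst; module ≡-Reasoning)
open import Relation.Nullary.Decidable
  using (Dec; does; yes; no; dec-false; dec-true; recompute; _×-dec_; ¬?)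
open import Relation.Nullary.Negation using (¬_; contradiction)
open import Relation.Unary using (Decidable; Pred)
open import Algebra.Properties.Semiring.Sum ℤ.+-*-semiring
  using (*-distribʳ-sum; *-distribˡ-sum; sum-cong-≗; sum-remove; sum-replicate-zero; ∑-comm; ∑-distrib-+)
  renaming (sum to ∑)

-- Linear algebra over ℤ

-- Chains of `Δ`, `Δ⟨ k ⟩` and `MC j` have different types of generators. All are moved into one
-- ambient complex of arbitrary tuples, where lying in a stage of the filtration is a condition on
-- coefficients, and moved back by `restrict`. A formal sum is a list that may repeat generators,
-- equal to another when the coefficients agree. Identities of chains are therefore proved by
-- pairing with functions on tuples, which turns the boundary `bd` into the coboundary `δ`.
--
-- Diagonality kills degree m only in the `MC j` with j ≠ m. Surjectivity in degree i lowers a cycle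
-- of degree i, but injectivity lowers a bounding chain of degree i + 1, and that avoids every j > k
-- once i + 1 ≤ k. This is why the isomorphisms stop below k.
--
-- The rank demanded is an exact number, so a family of cycles has to be constructed for it. A
-- maximal independent family takes the place of a ℤ-basis: it suffices for counting, and
-- elimination then needs only multiplication by nonzero pivots.

infixr 6.5 ∑-syntax

∑-syntax : ∀ n → (Fin n → ℤ) → ℤ
∑-syntax _ = ∑

syntax ∑-syntax n (λ i → x) = ∑[ i < n ] x

≢0-cancelˡ : ∀ {a b} → a ≢ 0ℤ → a * b ≡ 0ℤ → b ≡ 0ℤ
≢0-cancelˡ {a} a≢0 eq with ℤ.i*j≡0⇒i≡0∨j≡0 a eq
... | inj₁ a≡0 = contradiction a≡0 a≢0
... | inj₂ b≡0 = b≡0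

*-≢0 : ∀ {a b} → a ≢ 0ℤ → b ≢ 0ℤ → a * b ≢ 0ℤ
*-≢0 a≢0 b≢0 = b≢0 ∘ ≢0-cancelˡ a≢0

∑-zero : ∀ {n} (f : Fin n → ℤ) → (∀ i → f i ≡ 0ℤ) → ∑ f ≡ 0ℤ
∑-zero {n} f f≡0 = trans (sum-cong-≗ f≡0) (sum-replicate-zero n)

∑-neg : ∀ {n} (f : Fin n → ℤ) → ∑[ i < n ] (- f i) ≡ - ∑ f
∑-neg f = begin
  ∑ (λ i → - f i)           ≡⟨ sum-cong-≗ (λ i → ℤ.-1*i≡-i (f i)) ⟨
  ∑ (λ i → ℤ.-1ℤ * f i)     ≡⟨ *-distribˡ-sum ℤ.-1ℤ f ⟨
  ℤ.-1ℤ * ∑ f               ≡⟨ ℤ.-1*i≡-i (∑ f) ⟩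
  - ∑ f                     ∎
  where open ≡-Reasoning

∑-↑ : ∀ m {n} (f : Fin (m ℕ.+ n) → ℤ) → ∑ f ≡ ∑[ i < m ] f (i ↑ˡ n) + ∑[ j < n ] f (m ↑ʳ j)
∑-↑ zero    f = sym (ℤ.+-identityˡ _)
∑-↑ (suc m) f = trans (cong (f zero +_) (∑-↑ m (f ∘ suc))) (sym (ℤ.+-assoc (f zero) _ _))

unit : ∀ {n} → Fin n → Fin n → ℤ
unit zero    zero    = 1ℤ
unit zero    (suc j) = 0ℤ
unit (suc i) zero    = 0ℤ
unit (suc i) (suc j) = unit i j

∑-unit : ∀ {n} (f : Fin n → ℤ) i → ∑[ j < n ] f j * unit j i ≡ f i
∑-unit f zero = trans
  (cong₂ _+_ (ℤ.*-identityʳ (f zero)) (∑-zero _ λ j → ℤ.*-zeroʳ (f (suc j)))) (ℤ.+-identityʳ _)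
∑-unit f (suc i) = trans
  (cong₂ _+_ (ℤ.*-zeroʳ (f zero)) (∑-unit (f ∘ suc) i)) (ℤ.+-identityˡ _)

comb : ∀ {s n} → (Fin s → ℤ) → (Fin s → Fin n → ℤ) → Fin n → ℤ
comb {s} c v j = ∑[ i < s ] c i * v i j

comb-zero : ∀ {s n} {c : Fin s → ℤ} (v : Fin s → Fin n → ℤ) → (∀ i → c i ≡ 0ℤ) →
            ∀ j → comb c v j ≡ 0ℤ
comb-zero v c≡0 j = ∑-zero _ λ i → trans (cong (_* v i j) (c≡0 i)) (ℤ.*-zeroˡ (v i j))

∑-comb : ∀ {s n} (φ : Fin n → ℤ) c (v : Fin s → Fin n → ℤ) →
         ∑[ j < n ] φ j * comb c v j ≡ ∑[ i < s ] c i * (∑[ j < n ] φ j * v i j)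
∑-comb {s} {n} φ c v = begin
  ∑[ j < n ] φ j * comb c v j
    ≡⟨ sum-cong-≗ (λ j → *-distribˡ-sum (φ j) λ i → c i * v i j) ⟩
  ∑[ j < n ] ∑[ i < s ] φ j * (c i * v i j)
    ≡⟨ ∑-comm (λ j i → φ j * (c i * v i j)) ⟩
  ∑[ i < s ] ∑[ j < n ] φ j * (c i * v i j)
    ≡⟨ sum-cong-≗ (λ i → trans (sum-cong-≗ λ j → swap (φ j) (c i) (v i j))
                               (sym (*-distribˡ-sum (c i) λ j → φ j * v i j))) ⟩
  ∑[ i < s ] c i * (∑[ j < n ] φ j * v i j) ∎
  where
  open ≡-Reasoning
  swap : ∀ a b c → a * (b * c) ≡ b * (a * c)
  swap = solve-∀

comb-comb : ∀ {s t n} d (c : Fin s → Fin t → ℤ) (u : Fin t → Fin n → ℤ) j →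
            comb d (λ i → comb (c i) u) j ≡ comb (comb d c) u j
comb-comb {s} {t} d c u j = begin
  ∑[ i < s ] d i * (∑[ l < t ] c i l * u l j)
    ≡⟨ sum-cong-≗ (λ i → cong (d i *_) (sum-cong-≗ λ l → ℤ.*-comm (c i l) (u l j))) ⟩
  ∑[ i < s ] d i * (∑[ l < t ] u l j * c i l)
    ≡⟨ ∑-comb (λ l → u l j) d c ⟨
  ∑[ l < t ] u l j * comb d c l
    ≡⟨ sum-cong-≗ (λ l → ℤ.*-comm (u l j) (comb d c l)) ⟩
  ∑[ l < t ] comb d c l * u l j ∎
  where open ≡-Reasoning

infix 4 _⊥_

_⊥_ : ∀ {n} → (Fin n → ℤ) → (Fin n → ℤ) → Set
_⊥_ {n} φ w = ∑[ i < n ] φ i * w i ≡ 0ℤ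

Ker : ∀ {m n} → (Fin m → Fin n → ℤ) → (Fin n → ℤ) → Set
Ker A w = ∀ j → A j ⊥ w

⊥-linear : ∀ {n} (φ : Fin n → ℤ) a b x y → φ ⊥ x → φ ⊥ y → φ ⊥ (λ i → a * x i + b * y i)
⊥-linear {n} φ a b x y p q = begin
  ∑[ i < n ] φ i * (a * x i + b * y i)
    ≡⟨ sum-cong-≗ (λ i → distr (φ i) a (x i) b (y i)) ⟩
  ∑[ i < n ] (a * (φ i * x i) + b * (φ i * y i))
    ≡⟨ ∑-distrib-+ (λ i → a * (φ i * x i)) _ ⟩
  ∑[ i < n ] a * (φ i * x i) + ∑[ i < n ] b * (φ i * y i)
    ≡⟨ cong₂ _+_ (*-distribˡ-sum a λ i → φ i * x i) (*-distribˡ-sum b λ i → φ i * y i) ⟨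
  a * (∑[ i < n ] φ i * x i) + b * (∑[ i < n ] φ i * y i)
    ≡⟨ cong₂ (λ u v → a * u + b * v) p q ⟩
  a * 0ℤ + b * 0ℤ
    ≡⟨ cong₂ _+_ (ℤ.*-zeroʳ a) (ℤ.*-zeroʳ b) ⟩
  0ℤ ∎
  where
  open ≡-Reasoning
  distr : ∀ f a x b y → f * (a * x + b * y) ≡ a * (f * x) + b * (f * y)
  distr = solve-∀

Independent : ∀ {s n} → (Fin s → Fin n → ℤ) → Set
Independent v = ∀ c → (∀ j → comb c v j ≡ 0ℤ) → ∀ i → c i ≡ 0ℤ

-- Denominators are cleared: `w` is the rational combination of `v` with coefficients `c i / a`.
RationallySpans : ∀ {s n} → (Fin s → Fin n → ℤ) → (Fin n → ℤ) → Set
RationallySpans v w = ∃[ a ] a ≢ 0ℤ × ∃[ c ] ∀ j → a * w j ≡ comb c v j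

-- A maximal independent family; it need not generate K over ℤ.
record RationalBasis {n} (K : (Fin n → ℤ) → Set) (s : ℕ) : Set where
  field
    vec         : Fin s → Fin n → ℤ
    vec∈        : ∀ i → K (vec i)
    independent : Independent vec
    spans       : ∀ w → K w → RationallySpans vec w

module _ {n} {K : (Fin n → ℤ) → Set} (φ : Fin n → ℤ)
         (K-linear : ∀ a b {x y} → K x → K y → K (λ i → a * x i + b * y i)) where

  private
    pair : (Fin n → ℤ) → ℤ
    pair w = ∑[ j < n ] φ j * w j

  -- One step of elimination without division. If some basis vector `v p` has pairing α ≠ 0 with φ,
  -- every other `v i` is replaced by α v i - β i v p, where β i is its own pairing with φ; this
  -- kills the pairing at the cost of one vector. Without such a pivot the whole basis already lies
  -- in the kernel of φ.
  cut′ : ∀ {s} (B : RationalBasis K s) →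
         Dec (∃[ i ] pair (RationalBasis.vec B i) ≢ 0ℤ) →
         ∃[ t ] s ℕ.≤ suc t × RationalBasis (λ w → φ ⊥ w × K w) t
  cut′ {s} B (no ∄i) = s , ℕ.n≤1+n s , record
    { vec         = vec
    ; vec∈        = λ i → all⊥ i , vec∈ i
    ; independent = independent
    ; spans       = λ w (_ , w∈) → spans w w∈
    }
    where
    open RationalBasis B
    all⊥ : ∀ i → φ ⊥ vec i
    all⊥ i with pair (vec i) ℤ.≟ 0ℤ
    ... | yes p = p
    ... | no ¬p = contradiction (i , ¬p) ∄i
  cut′ {suc t} B (yes (p , α≢0)) = t , ℕ.≤-refl , record
    { vec         = u
    ; vec∈        = λ i → u⊥ i , K-linear α (- β i) (vec∈ (punchIn p i)) (vec∈ p)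
    ; independent = u-independent
    ; spans       = u-spans
    }
    where
    open RationalBasis B
    open ≡-Reasoning
    v = vec
    α = pair (v p)
    β : Fin t → ℤ
    β i = pair (v (punchIn p i))
    u : Fin t → Fin n → ℤ
    u i j = α * v (punchIn p i) j + - β i * v p j

    u⊥ : ∀ i → φ ⊥ u i
    u⊥ i = begin
      ∑[ j < n ] φ j * (α * v (punchIn p i) j + - β i * v p j)
        ≡⟨ sum-cong-≗ (λ j → distr (φ j) α (v (punchIn p i) j) (- β i) (v p j)) ⟩
      ∑[ j < n ] (α * (φ j * v (punchIn p i) j) + - β i * (φ j * v p j))
        ≡⟨ ∑-distrib-+ (λ j → α * (φ j * v (punchIn p i) j)) _ ⟩
      ∑[ j < n ] α * (φ j * v (punchIn p i) j) + ∑[ j < n ] - β i * (φ j * v p j)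
        ≡⟨ cong₂ _+_ (*-distribˡ-sum α λ j → φ j * v (punchIn p i) j)
                     (*-distribˡ-sum (- β i) λ j → φ j * v p j) ⟨
      α * β i + - β i * α
        ≡⟨ cancel α (β i) ⟩
      0ℤ ∎
      where
      distr : ∀ f a x b y → f * (a * x + b * y) ≡ a * (f * x) + b * (f * y)
      distr = solve-∀
      cancel : ∀ a b → a * b + - b * a ≡ 0ℤ
      cancel = solve-∀

    comb-u : ∀ d j → comb d u j ≡ ∑[ i < t ] d i * α * v (punchIn p i) j
                                  + - (∑[ i < t ] d i * β i) * v p j
    comb-u d j = begin
      ∑[ i < t ] d i * u i j
        ≡⟨ sum-cong-≗ (λ i → distr (d i) α (v (punchIn p i) j) (β i) (v p j)) ⟩
      ∑[ i < t ] (d i * α * v (punchIn p i) j + - (d i * β i) * v p j)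
        ≡⟨ ∑-distrib-+ (λ i → d i * α * v (punchIn p i) j) _ ⟩
      ∑[ i < t ] d i * α * v (punchIn p i) j + ∑[ i < t ] - (d i * β i) * v p j
        ≡⟨ cong (∑[ i < t ] d i * α * v (punchIn p i) j +_)
             (trans (cong (_* v p j) (sym (∑-neg λ i → d i * β i)))
                    (*-distribʳ-sum (v p j) λ i → - (d i * β i))) ⟨
      ∑[ i < t ] d i * α * v (punchIn p i) j + - (∑[ i < t ] d i * β i) * v p j ∎
      where
      distr : ∀ d a x b y → d * (a * x + - b * y) ≡ d * a * x + - (d * b) * y
      distr = solve-∀

    u-independent : Independent u
    u-independent d d-rel i = ≢0-cancelˡ α≢0 (trans (ℤ.*-comm α (d i))
      (trans (sym (VF.insertAt-punchIn dα p c₀ i)) (independent c c-rel (punchIn p i))))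
      where
      -- A relation `d` among the `u i` is a relation among the `v i`, with `d i * α` away from the
      -- pivot and `c₀` at the pivot.
      dα : Fin t → ℤ
      dα i = d i * α
      c₀ = - (∑[ i < t ] d i * β i)
      c : Fin (suc t) → ℤ
      c = insertAt dα p c₀
      c-rel : ∀ j → comb c v j ≡ 0ℤ
      c-rel j = begin
        comb c v j
          ≡⟨ sum-remove {i = p} (λ i → c i * v i j) ⟩
        c p * v p j + ∑[ i < t ] c (punchIn p i) * v (punchIn p i) j
          ≡⟨ cong₂ _+_ (cong (_* v p j) (VF.insertAt-lookup dα p c₀))
               (sum-cong-≗ λ i → cong (_* v (punchIn p i) j) (VF.insertAt-punchIn dα p c₀ i)) ⟩
        c₀ * v p j + ∑[ i < t ] dα i * v (punchIn p i) j
          ≡⟨ ℤ.+-comm (c₀ * v p j) _ ⟩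
        ∑[ i < t ] dα i * v (punchIn p i) j + c₀ * v p j
          ≡⟨ comb-u d j ⟨
        comb d u j
          ≡⟨ d-rel j ⟩
        0ℤ ∎

    u-spans : ∀ w → φ ⊥ w × K w → RationallySpans u w
    u-spans w (w⊥ , w∈) with spans w w∈
    ... | a , a≢0 , c , aw = α * a , *-≢0 α≢0 a≢0 , c ∘ punchIn p , λ j → begin
      α * a * w j
        ≡⟨ ℤ.*-assoc α a (w j) ⟩
      α * (a * w j)
        ≡⟨ cong (α *_) (trans (aw j) (sum-remove {i = p} (λ i → c i * v i j))) ⟩
      α * (c p * v p j + ∑[ i < t ] c (punchIn p i) * v (punchIn p i) j)
        ≡⟨ distr₁ α (c p) (v p j) _ ⟩
      α * (∑[ i < t ] c (punchIn p i) * v (punchIn p i) j) + c p * α * v p j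
        ≡⟨ cong₂ (λ x y → x + y * v p j)
             (trans (*-distribˡ-sum α λ i → c (punchIn p i) * v (punchIn p i) j)
                    (sum-cong-≗ λ i → swap α (c (punchIn p i)) _))
             pivot ⟩
      ∑[ i < t ] c (punchIn p i) * α * v (punchIn p i) j
        + - (∑[ i < t ] c (punchIn p i) * β i) * v p j
        ≡⟨ comb-u (c ∘ punchIn p) j ⟨
      comb (c ∘ punchIn p) u j ∎
      where
      distr₁ : ∀ a x y z → a * (x * y + z) ≡ a * z + x * a * y
      distr₁ = solve-∀
      swap : ∀ a b x → a * (b * x) ≡ b * a * x
      swap = solve-∀
      moveʳ : ∀ x y → x + y ≡ 0ℤ → x ≡ - y
      moveʳ x y eq = trans (shuffle x y) (trans (cong (_- y) eq) (ℤ.+-identityˡ (- y)))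
        where
        shuffle : ∀ x y → x ≡ x + y - y
        shuffle = solve-∀
      -- Pairing φ with `a w = Σ c i v i` gives 0, since φ ⊥ w. Hence the other coefficients
      -- determine the one at the pivot.
      pivot : c p * α ≡ - (∑[ i < t ] c (punchIn p i) * β i)
      pivot = moveʳ (c p * α) _ (begin
        c p * α + ∑[ i < t ] c (punchIn p i) * β i
          ≡⟨ sum-remove {i = p} (λ i → c i * pair (v i)) ⟨
        ∑[ i < suc t ] c i * pair (v i)
          ≡⟨ ∑-comb φ c v ⟨
        ∑[ j < n ] φ j * comb c v j
          ≡⟨ sum-cong-≗ (λ j → trans (cong (φ j *_) (sym (aw j))) (swap′ (φ j) a (w j))) ⟩
        ∑[ j < n ] a * (φ j * w j)
          ≡⟨ *-distribˡ-sum a (λ j → φ j * w j) ⟨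
        a * pair w
          ≡⟨ cong (a *_) w⊥ ⟩
        a * 0ℤ
          ≡⟨ ℤ.*-zeroʳ a ⟩
        0ℤ ∎)
        where
        swap′ : ∀ a b x → a * (b * x) ≡ b * (a * x)
        swap′ = solve-∀

  cut : ∀ {s} → RationalBasis K s → ∃[ t ] s ℕ.≤ suc t × RationalBasis (λ w → φ ⊥ w × K w) t
  cut B = cut′ B (Fin.any? λ i → ¬? (pair (RationalBasis.vec B i) ℤ.≟ 0ℤ))

basis-resp : ∀ {n s} {K K′ : (Fin n → ℤ) → Set} → (∀ {w} → K w → K′ w) → (∀ {w} → K′ w → K w) →
             RationalBasis K s → RationalBasis K′ s
basis-resp f g B = record
  { vec = vec ; vec∈ = f ∘ vec∈ ; independent = independent ; spans = λ w → spans w ∘ g }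
  where open RationalBasis B

-- Starting from the standard basis of ℤⁿ, the rows are imposed one at a time, and each costs at
-- most one dimension.
ker-basis : ∀ {m n} (A : Fin m → Fin n → ℤ) → ∃[ t ] n ℕ.≤ m ℕ.+ t × RationalBasis (Ker A) t
ker-basis {zero} {n} A = n , ℕ.≤-refl , record
  { vec         = unit
  ; vec∈        = λ _ ()
  ; independent = λ c eq i → trans (sym (∑-unit c i)) (eq i)
  ; spans       = λ w _ → 1ℤ , (λ ()) , w , λ j → trans (ℤ.*-identityˡ (w j)) (sym (∑-unit w j))
  }
ker-basis {suc m} A with ker-basis (A ∘ suc)
... | t , n≤m+t , B
  with cut (A zero) (λ a b {x} {y} p q j → ⊥-linear (A (suc j)) a b x y (p j) (q j)) B
... | t′ , t≤1+t′ , B′ =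
  t′ , ℕ.≤-trans n≤m+t (subst (m ℕ.+ t ℕ.≤_) (ℕ.+-suc m t′) (ℕ.+-monoʳ-≤ m t≤1+t′))
     , basis-resp (λ { (p , q) zero → p ; (p , q) (suc j) → q j }) (λ p → p zero , p ∘ suc) B′

-- With s > n the n coordinates impose too few conditions on s coefficients, so the kernel of the
-- transposed matrix has a nonempty independent family. Its first member is a relation among the
-- `v i`, hence zero, and a family containing zero is not independent.
independent⇒≤ : ∀ {s n} (v : Fin s → Fin n → ℤ) → Independent v → s ℕ.≤ n
independent⇒≤ {s} {n} v v-ind with ker-basis (λ j i → v i j)
... | zero  , s≤n+t , _ = subst (s ℕ.≤_) (ℕ.+-identityʳ n) s≤n+t
... | suc t , _ , B =
  contradiction (independent (unit zero) (comb-zero′) zero) λ ()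
  where
  open RationalBasis B
  vec₀≡0 : ∀ i → vec zero i ≡ 0ℤ
  vec₀≡0 = v-ind (vec zero) λ j →
    trans (sum-cong-≗ λ i → ℤ.*-comm (vec zero i) (v i j)) (vec∈ zero j)
  comb-zero′ : ∀ j → comb (unit zero) vec j ≡ 0ℤ
  comb-zero′ j = trans (cong₂ _+_ (trans (ℤ.*-identityˡ (vec zero j)) (vec₀≡0 j))
                                  (comb-zero (vec ∘ suc) (λ _ → refl) j)) refl

-- The coefficient vectors of the `v i` over `u` are themselves independent in ℤᵗ: a relation `d`
-- among them becomes the relation `d i * a i` among the `v i` once the denominators `a i` are
-- restored. So the bound for families in ℤᵗ applies.
steinitz : ∀ {s t n} (v : Fin s → Fin n → ℤ) (u : Fin t → Fin n → ℤ) →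
           Independent v → (∀ i → RationallySpans u (v i)) → s ℕ.≤ t
steinitz {s} v u v-ind spanned = independent⇒≤ c λ d d-rel i →
  ≢0-cancelˡ (proj₁ (proj₂ (spanned i))) (trans (ℤ.*-comm (a i) (d i))
    (v-ind (λ i → d i * a i) (λ j → begin
      ∑[ i < s ] d i * a i * v i j
        ≡⟨ sum-cong-≗ (λ i → trans (ℤ.*-assoc (d i) (a i) (v i j)) (cong (d i *_) (av i j))) ⟩
      comb d (λ i → comb (c i) u) j
        ≡⟨ comb-comb d c u j ⟩
      comb (comb d c) u j
        ≡⟨ comb-zero u d-rel j ⟩
      0ℤ ∎) i))
  where
  open ≡-Reasoning
  a = λ i → proj₁ (spanned i)
  c = λ i → proj₁ (proj₂ (proj₂ (spanned i)))
  av = λ i → proj₂ (proj₂ (proj₂ (spanned i)))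

infixl 7 _∙_

_∙_ : ∀ {m n} → (Fin m → Fin n → ℤ) → (Fin n → ℤ) → Fin m → ℤ
_∙_ {n = n} A w j = ∑[ i < n ] A j i * w i

∙-comb : ∀ {m n s} (A : Fin m → Fin n → ℤ) c (v : Fin s → Fin n → ℤ) j →
         (A ∙ comb c v) j ≡ comb c (λ i → A ∙ v i) j
∙-comb A c v j = ∑-comb (A j) c v

module _ {m n p q} (A : Fin m → Fin n → ℤ) {K : (Fin m → ℤ) → Set}
         (Z : RationalBasis (Ker A) p) (B : RationalBasis K q)
         (image⊆K : ∀ w → K (A ∙ w)) (K⊆image : ∀ {y} → K y → ∃[ w ] ∀ j → (A ∙ w) j ≡ y j) where
  private
    module Z = RationalBasis Z
    module B = RationalBasis B
    open ≡-Reasoning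

    lift : Fin q → Fin n → ℤ
    lift i = proj₁ (K⊆image (B.vec∈ i))

    A-lift : ∀ i j → (A ∙ lift i) j ≡ B.vec i j
    A-lift i = proj₂ (K⊆image (B.vec∈ i))

    A-comb-lift : ∀ c j → (A ∙ comb c lift) j ≡ comb c B.vec j
    A-comb-lift c j =
      trans (∙-comb A c lift j) (sum-cong-≗ λ i → cong (c i *_) (A-lift i j))

    A-comb-Z : ∀ c j → (A ∙ comb c Z.vec) j ≡ 0ℤ
    A-comb-Z c j = trans (∙-comb A c Z.vec j)
      (∑-zero _ λ i → trans (cong (c i *_) (Z.vec∈ i j)) (ℤ.*-zeroʳ (c i)))

    ∙-+ : ∀ w w′ j → (A ∙ (λ i → w i + w′ i)) j ≡ (A ∙ w) j + (A ∙ w′) j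
    ∙-+ w w′ j = trans (sum-cong-≗ λ i → ℤ.*-distribˡ-+ (A j i) (w i) (w′ i))
                       (∑-distrib-+ (λ i → A j i * w i) _)

    both : Fin (p ℕ.+ q) → Fin n → ℤ
    both = Z.vec VF.++ lift

    comb-both : ∀ c j → comb c both j ≡ comb (c ∘ (_↑ˡ q)) Z.vec j + comb (c ∘ (p ↑ʳ_)) lift j
    comb-both c j = trans (∑-↑ p _) (cong₂ _+_
      (sum-cong-≗ λ i → cong (λ v → c (i ↑ˡ q) * v j) (VF.lookup-++ˡ Z.vec lift i))
      (sum-cong-≗ λ i → cong (λ v → c (p ↑ʳ i) * v j) (VF.lookup-++ʳ Z.vec lift i)))

    both-independent : Independent both
    both-independent c c-rel i =
      subst (λ i → c i ≡ 0ℤ) (Fin.join-splitAt p q i) (on-join (splitAt p i))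
      where
      A-comb : ∀ j → comb (c ∘ (p ↑ʳ_)) B.vec j ≡ 0ℤ
      A-comb j = begin
        comb (c ∘ (p ↑ʳ_)) B.vec j
          ≡⟨ trans (cong₂ _+_ (A-comb-Z (c ∘ (_↑ˡ q)) j) (A-comb-lift (c ∘ (p ↑ʳ_)) j))
                   (ℤ.+-identityˡ _) ⟨
        (A ∙ comb (c ∘ (_↑ˡ q)) Z.vec) j + (A ∙ comb (c ∘ (p ↑ʳ_)) lift) j
          ≡⟨ ∙-+ (comb (c ∘ (_↑ˡ q)) Z.vec) (comb (c ∘ (p ↑ʳ_)) lift) j ⟨
        (A ∙ (λ i → comb (c ∘ (_↑ˡ q)) Z.vec i + comb (c ∘ (p ↑ʳ_)) lift i)) j
          ≡⟨ ∑-zero _ (λ i → trans (cong (A j i *_) (trans (sym (comb-both c i)) (c-rel i)))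
                                   (ℤ.*-zeroʳ (A j i))) ⟩
        0ℤ ∎
      right : ∀ i → c (p ↑ʳ i) ≡ 0ℤ
      right = B.independent _ A-comb
      left : ∀ i → c (i ↑ˡ q) ≡ 0ℤ
      left = Z.independent _ λ j → begin
        comb (c ∘ (_↑ˡ q)) Z.vec j
          ≡⟨ ℤ.+-identityʳ _ ⟨
        comb (c ∘ (_↑ˡ q)) Z.vec j + 0ℤ
          ≡⟨ cong (comb (c ∘ (_↑ˡ q)) Z.vec j +_) (comb-zero lift right j) ⟨
        comb (c ∘ (_↑ˡ q)) Z.vec j + comb (c ∘ (p ↑ʳ_)) lift j
          ≡⟨ comb-both c j ⟨
        comb c both j
          ≡⟨ c-rel j ⟩
        0ℤ ∎
      on-join : ∀ x → c (join p q x) ≡ 0ℤ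
      on-join (inj₁ i) = left i
      on-join (inj₂ i) = right i

    remainder : ∀ w {a c} → (∀ j → a * (A ∙ w) j ≡ comb c B.vec j) →
                Ker A (λ i → a * w i + - comb c lift i)
    remainder w {a} {c} aAw j = begin
      (A ∙ (λ i → a * w i + - comb c lift i)) j
        ≡⟨ sum-cong-≗ (λ i → distr (A j i) a (w i) (comb c lift i)) ⟩
      ∑[ i < n ] (a * (A j i * w i) + - (A j i * comb c lift i))
        ≡⟨ ∑-distrib-+ (λ i → a * (A j i * w i)) _ ⟩
      ∑[ i < n ] a * (A j i * w i) + ∑[ i < n ] - (A j i * comb c lift i)
        ≡⟨ cong₂ _+_ (sym (*-distribˡ-sum a λ i → A j i * w i)) (∑-neg λ i → A j i * comb c lift i) ⟩
      a * (A ∙ w) j + - (A ∙ comb c lift) j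
        ≡⟨ cong₂ (λ x y → x + - y) (aAw j) (A-comb-lift c j) ⟩
      comb c B.vec j + - comb c B.vec j
        ≡⟨ ℤ.+-inverseʳ (comb c B.vec j) ⟩
      0ℤ ∎
      where
      distr : ∀ f a x y → f * (a * x + - y) ≡ a * (f * x) + - (f * y)
      distr = solve-∀

    both-spans : ∀ w → RationallySpans both w
    both-spans w with B.spans _ (image⊆K w)
    ... | a , a≢0 , c , aAw with Z.spans _ (remainder w {a} {c} aAw)
    -- Two denominators occur: `a` expresses the image of `w` over `B.vec`, and `b` expresses the
    -- remainder in the kernel over `Z.vec`.
    ... | b , b≢0 , d , eq = b * a , *-≢0 b≢0 a≢0 , d VF.++ bc , λ j → begin
        b * a * w j
          ≡⟨ split b a (w j) (comb c lift j) ⟩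
        b * (a * w j + - comb c lift j) + b * comb c lift j
          ≡⟨ cong₂ _+_ (eq j) (trans (*-distribˡ-sum b λ i → c i * lift i j)
               (sum-cong-≗ λ i → sym (ℤ.*-assoc b (c i) (lift i j)))) ⟩
        comb d Z.vec j + comb bc lift j
          ≡⟨ cong₂ _+_ (sum-cong-≗ λ i → cong (_* Z.vec i j) (VF.lookup-++ˡ d bc i))
                       (sum-cong-≗ λ i → cong (_* lift i j) (VF.lookup-++ʳ d bc i)) ⟨
        comb ((d VF.++ bc) ∘ (_↑ˡ q)) Z.vec j + comb ((d VF.++ bc) ∘ (p ↑ʳ_)) lift j
          ≡⟨ comb-both (d VF.++ bc) j ⟨
        comb (d VF.++ bc) both j ∎
      where
      bc : Fin q → ℤ
      bc i = b * c i
      split : ∀ b a w x → b * a * w ≡ b * (a * w + - x) + b * x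
      split = solve-∀

  -- `both`, a basis of the kernel followed by preimages of a basis of the image, is a rational
  -- basis of ℤⁿ. Its independence bounds p + q by n; since it spans the unit vectors, `steinitz`
  -- gives the converse.
  rank-nullity : p ℕ.+ q ≡ n
  rank-nullity = ℕ.≤-antisym (independent⇒≤ both both-independent)
    (steinitz unit both (λ c eq i → trans (sym (∑-unit c i)) (eq i)) (both-spans ∘ unit))

-- Formal sums and the boundary of tuples

ext : ∀ {B : Set} → (B → ℤ) → FormalSum B → ℤ
ext f []            = 0ℤ
ext f ((a , b) ∷ c) = a * f b + ext f c

module _ {B : Set} where
  open ≡-Reasoning

  ext-++ : ∀ (f : B → ℤ) c c′ → ext f (c ++ c′) ≡ ext f c + ext f c′
  ext-++ f []            c′ = sym (ℤ.+-identityˡ _)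
  ext-++ f ((a , b) ∷ c) c′ = trans (cong (a * f b +_) (ext-++ f c c′)) (sym (ℤ.+-assoc (a * f b) _ _))

  ext-scale : ∀ (f : B → ℤ) k c → ext f (scale k c) ≡ k * ext f c
  ext-scale f k []            = sym (ℤ.*-zeroʳ k)
  ext-scale f k ((a , b) ∷ c) =
    trans (cong (k * a * f b +_) (ext-scale f k c)) (lemma k a (f b) (ext f c))
    where
    lemma : ∀ k a x y → k * a * x + k * y ≡ k * (a * x + y)
    lemma = solve-∀

  ext-cong : ∀ {f g : B → ℤ} → (∀ b → f b ≡ g b) → ∀ c → ext f c ≡ ext g c
  ext-cong f≗g []            = refl
  ext-cong f≗g ((a , b) ∷ c) = cong₂ _+_ (cong (a *_) (f≗g b)) (ext-cong f≗g c)

  ext-zero : ∀ {f : B → ℤ} → (∀ b → f b ≡ 0ℤ) → ∀ c → ext f c ≡ 0ℤ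
  ext-zero f≡0 []            = refl
  ext-zero f≡0 ((a , b) ∷ c) =
    cong₂ _+_ (trans (cong (a *_) (f≡0 b)) (ℤ.*-zeroʳ a)) (ext-zero f≡0 c)

  ext-linear : ∀ {D : Set} (f : B → ℤ) (g : D → FormalSum B) c →
               ext f (linear g c) ≡ ext (ext f ∘ g) c
  ext-linear f g []            = refl
  ext-linear f g ((a , d) ∷ c) = trans (ext-++ f (scale a (g d)) (linear g c))
    (cong₂ _+_ (ext-scale f a (g d)) (ext-linear f g c))

  ext-alternatingSum : ∀ {n} (f : B → ℤ) (F : Fin n → FormalSum B) →
                       ext f (alternatingSum F) ≡ ∑[ i < n ] sign i * ext f (F i)
  ext-alternatingSum {n} f F = go (λ i → i)
    where
    go : ∀ {m} (h : Fin m → Fin n) →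
         ext f (concatMap (λ i → scale (sign i) (F i)) (tabulate h)) ≡
         ∑[ i < m ] sign (h i) * ext f (F (h i))
    go {zero}  h = refl
    go {suc m} h = trans (ext-++ f (scale (sign (h zero)) (F (h zero))) _)
      (cong₂ _+_ (ext-scale f (sign (h zero)) (F (h zero))) (go (h ∘ suc)))

module _ {B : Set} (_≟_ : DecidableEquality B) where
  open Coefficients _≟_
  open ≡-Reasoning

  ind : B → B → ℤ
  ind b b′ = if does (b′ ≟ b) then 1ℤ else 0ℤ

  ind-refl : ∀ b → ind b b ≡ 1ℤ
  ind-refl b rewrite dec-true (b ≟ b) refl = refl

  ind-≢ : ∀ {b b′} → b′ ≢ b → ind b b′ ≡ 0ℤ
  ind-≢ {b} {b′} b′≢b rewrite dec-false (b′ ≟ b) b′≢b = refl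

  coef-ext : ∀ c b → coef c b ≡ ext (ind b) c
  coef-ext []             b = refl
  coef-ext ((a , b′) ∷ c) b = cong₂ _+_ head (coef-ext c b)
    where
    head : (if does (b′ ≟ b) then a else 0ℤ) ≡ a * ind b b′
    head with does (b′ ≟ b)
    ... | true  = sym (ℤ.*-identityʳ a)
    ... | false = sym (ℤ.*-zeroʳ a)

  private
    erase : B → FormalSum B → FormalSum B
    erase x []            = []
    erase x ((a , b) ∷ c) with b ≟ x
    ... | yes _ = erase x c
    ... | no  _ = (a , b) ∷ erase x c

    length-erase : ∀ x c → length (erase x c) ℕ.≤ length c
    length-erase x []            = z≤n
    length-erase x ((a , b) ∷ c) with b ≟ x
    ... | yes _ = ℕ.m≤n⇒m≤1+n (length-erase x c)
    ... | no  _ = s≤s (length-erase x c)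

    ext-erase : ∀ f x c → ext f c ≡ coef c x * f x + ext f (erase x c)
    ext-erase f x []            = sym (trans (ℤ.+-identityʳ (0ℤ * f x)) (ℤ.*-zeroˡ (f x)))
    ext-erase f x ((a , b) ∷ c) with b ≟ x
    ... | yes refl = trans (cong (a * f b +_) (ext-erase f x c))
      (lemma a (f b) (coef c b) (ext f (erase b c)))
      where
      lemma : ∀ a u v w → a * u + (v * u + w) ≡ (a + v) * u + w
      lemma = solve-∀
    ... | no  _    = trans (cong (a * f b +_) (ext-erase f x c))
      (lemma (a * f b) (f x) (coef c x) (ext f (erase x c)))
      where
      lemma : ∀ a u v w → a + (v * u + w) ≡ (0ℤ + v) * u + (a + w)
      lemma = solve-∀

    erase-head : ∀ a x c → length (erase x ((a , x) ∷ c)) ℕ.≤ length c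
    erase-head a x c with x ≟ x
    ... | yes _  = length-erase x c
    ... | no x≢x = contradiction refl x≢x

  -- Vanishing coefficients do not make the list empty, since entries at a repeated generator may
  -- cancel. All entries at the head generator are removed together: they contribute
  -- `coef c x * f x`, which is zero, and the coefficients at other generators do not change. The
  -- recursion runs on a bound for the length because `erase x c` is not a structural part of `c`.
  ext-coef-zero : ∀ (f : B → ℤ) c → (∀ b → coef c b * f b ≡ 0ℤ) → ext f c ≡ 0ℤ
  ext-coef-zero f c = go (length c) c ℕ.≤-refl
    where
    go : ∀ n c → length c ℕ.≤ n → (∀ b → coef c b * f b ≡ 0ℤ) → ext f c ≡ 0ℤ
    go n       []              l       z = refl
    go (suc n) c@((a , x) ∷ c′) (s≤s l) z = begin
      ext f c
        ≡⟨ ext-erase f x c ⟩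
      coef c x * f x + ext f (erase x c)
        ≡⟨ cong₂ _+_ (z x) (go n (erase x c) (ℕ.≤-trans (erase-head a x c′) l) z′) ⟩
      0ℤ ∎
      where
      coef-erase : ∀ b → coef c b ≡ coef c x * ind b x + coef (erase x c) b
      coef-erase b = trans (coef-ext c b) (trans (ext-erase (ind b) x c)
        (cong (coef c x * ind b x +_) (sym (coef-ext (erase x c) b))))
      z′ : ∀ b → coef (erase x c) b * f b ≡ 0ℤ
      z′ b = by-cases (x ≟ b)
        where
        lemma₁ : ∀ u v → u * 1ℤ + v - u ≡ v
        lemma₁ = solve-∀
        lemma₂ : ∀ u v → u * 0ℤ + v ≡ v
        lemma₂ = solve-∀
        by-cases : Dec (x ≡ b) → coef (erase x c) b * f b ≡ 0ℤ
        by-cases (yes refl) = trans (cong (_* f x) (begin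
          coef (erase x c) x
            ≡⟨ lemma₁ (coef c x) _ ⟨
          coef c x * 1ℤ + coef (erase x c) x - coef c x
            ≡⟨ cong (λ u → coef c x * u + coef (erase x c) x - coef c x) (ind-refl x) ⟨
          coef c x * ind x x + coef (erase x c) x - coef c x
            ≡⟨ cong (_- coef c x) (coef-erase x) ⟨
          coef c x - coef c x
            ≡⟨ ℤ.+-inverseʳ (coef c x) ⟩
          0ℤ ∎)) (ℤ.*-zeroˡ (f x))
        by-cases (no x≢b) = trans (cong (_* f b) (begin
          coef (erase x c) b
            ≡⟨ lemma₂ (coef c x) _ ⟨
          coef c x * 0ℤ + coef (erase x c) b
            ≡⟨ cong (λ u → coef c x * u + coef (erase x c) b) (ind-≢ x≢b) ⟨
          coef c x * ind b x + coef (erase x c) b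
            ≡⟨ coef-erase b ⟨
          coef c b ∎)) (z b)

  ext-resp-≈ : ∀ (f : B → ℤ) {c c′} → c ≈ c′ → ext f c ≡ ext f c′
  ext-resp-≈ f {c} {c′} c≈c′ = ℤ.i-j≡0⇒i≡j (ext f c) (ext f c′) (begin
    ext f c - ext f c′             ≡⟨ cong (ext f c +_) (ℤ.-1*i≡-i (ext f c′)) ⟨
    ext f c + -1ℤ * ext f c′       ≡⟨ cong (ext f c +_) (ext-scale f -1ℤ c′) ⟨
    ext f c + ext f (negate c′)    ≡⟨ ext-++ f c (negate c′) ⟨
    ext f (c ++ negate c′)         ≡⟨ ext-coef-zero f (c ++ negate c′) (λ b →
                                        trans (cong (_* f b) (zero-diff b)) (ℤ.*-zeroˡ (f b))) ⟩
    0ℤ                             ∎)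
    where
    zero-diff : ∀ b → coef (c ++ negate c′) b ≡ 0ℤ
    zero-diff b = trans (coef-++ c (negate c′) b)
      (trans (cong₂ _+_ (c≈c′ b) (coef-negate c′ b)) (ℤ.+-inverseʳ (coef c′ b)))

  coef-diff : ∀ c c′ b → coef (c ++ negate c′) b ≡ coef c b - coef c′ b
  coef-diff c c′ b = trans (coef-++ c (negate c′) b) (cong (coef c b +_) (coef-negate c′ b))

module _ {A : Set} where
  open ≡-Reasoning

  -- The coboundary: extended to chains, δ f is f ∘ ∂.
  δ : ∀ {n} → (Vec A n → ℤ) → Vec A (suc n) → ℤ
  δ {n} f t = ∑[ i < suc n ] sign i * f (removeAt t i)

  δ-cong : ∀ {n} {f g : Vec A n → ℤ} → (∀ t → f t ≡ g t) → ∀ t → δ f t ≡ δ g t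
  δ-cong f≗g t = sum-cong-≗ λ i → cong (sign i *_) (f≗g (removeAt t i))

  δ-cons : ∀ {n} (f : Vec A (suc n) → ℤ) x (t : Vec A (suc n)) →
           δ f (x ∷ t) ≡ f t - δ (f ∘ (x ∷_)) t
  δ-cons {n} f x t@(_ ∷ _) = cong₂ _+_ (ℤ.*-identityˡ (f t)) (begin
    ∑[ i < suc n ] -1ℤ * sign i * f (x ∷ removeAt t i)
      ≡⟨ sum-cong-≗ (λ i → ℤ.*-assoc -1ℤ (sign i) (f (x ∷ removeAt t i))) ⟩
    ∑[ i < suc n ] -1ℤ * (sign i * f (x ∷ removeAt t i))
      ≡⟨ *-distribˡ-sum -1ℤ (λ i → sign i * f (x ∷ removeAt t i)) ⟨
    -1ℤ * δ (f ∘ (x ∷_)) t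
      ≡⟨ ℤ.-1*i≡-i (δ (f ∘ (x ∷_)) t) ⟩
    - δ (f ∘ (x ∷_)) t ∎)

  δ-minus : ∀ {n} (f g : Vec A n → ℤ) t → δ (λ s → f s - g s) t ≡ δ f t - δ g t
  δ-minus {n} f g t = begin
    ∑[ i < suc n ] sign i * (f (removeAt t i) - g (removeAt t i))
      ≡⟨ sum-cong-≗ (λ i → lemma (sign i) (f (removeAt t i)) (g (removeAt t i))) ⟩
    ∑[ i < suc n ] (sign i * f (removeAt t i) + - (sign i * g (removeAt t i)))
      ≡⟨ ∑-distrib-+ (λ i → sign i * f (removeAt t i)) (λ i → - (sign i * g (removeAt t i))) ⟩
    δ f t + ∑[ i < suc n ] - (sign i * g (removeAt t i))
      ≡⟨ cong (δ f t +_) (∑-neg λ i → sign i * g (removeAt t i)) ⟩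
    δ f t - δ g t ∎
    where
    lemma : ∀ s u v → s * (u - v) ≡ s * u + - (s * v)
    lemma = solve-∀

  -- By `δ-cons`, applied outside and inside, the two copies of `δ f t` cancel, and what remains is
  -- the same claim for `f ∘ (x ∷_)` on the shorter tuple. This replaces the bookkeeping with pairs
  -- of faces.
  δδ≡0 : ∀ {n} (f : Vec A n → ℤ) (t : Vec A (suc (suc n))) → δ (δ f) t ≡ 0ℤ
  δδ≡0 {zero} f (x ∷ y ∷ []) = lemma (f [])
    where
    lemma : ∀ u → 1ℤ * (1ℤ * u + 0ℤ) + (-1ℤ * (1ℤ * u + 0ℤ) + 0ℤ) ≡ 0ℤ
    lemma = solve-∀
  δδ≡0 {suc n} f (x ∷ t) = begin
    δ (δ f) (x ∷ t)
      ≡⟨ δ-cons (δ f) x t ⟩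
    δ f t - δ (λ s → δ f (x ∷ s)) t
      ≡⟨ cong (λ u → δ f t - u) (trans (δ-cong (δ-cons f x) t) (δ-minus f (δ (f ∘ (x ∷_))) t)) ⟩
    δ f t - (δ f t - δ (δ (f ∘ (x ∷_))) t)
      ≡⟨ cong (λ u → δ f t - (δ f t - u)) (δδ≡0 (f ∘ (x ∷_)) t) ⟩
    δ f t - (δ f t - 0ℤ)
      ≡⟨ lemma (δ f t) ⟩
    0ℤ ∎
    where
    lemma : ∀ u → u - (u - 0ℤ) ≡ 0ℤ
    lemma = solve-∀

-- Complexes spanned by tuples, inside the complex of all tuples

module Ambient {A : Set} (_≟_ : DecidableEquality A) where

  _≟ⱽ_ : ∀ {n} → DecidableEquality (Vec A n)
  _≟ⱽ_ = Vec.≡-dec _≟_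

  module _ {n : ℕ} where
    open Coefficients (_≟ⱽ_ {n}) public

  faces : ∀ {n} → Vec A (suc n) → FormalSum (Vec A n)
  faces t = alternatingSum λ i → gen (removeAt t i)

  bd : ∀ {n} → FormalSum (Vec A (suc n)) → FormalSum (Vec A n)
  bd = linear faces

  𝟙 : ∀ {n} → Vec A n → Vec A n → ℤ
  𝟙 = ind _≟ⱽ_

  ext-faces : ∀ {n} (f : Vec A n → ℤ) t → ext f (faces t) ≡ δ f t
  ext-faces f t = trans (ext-alternatingSum f (λ i → gen (removeAt t i)))
    (sum-cong-≗ λ i → cong (sign i *_) (trans (ℤ.+-identityʳ _) (ℤ.*-identityˡ (f (removeAt t i)))))

  ext-bd : ∀ {n} (f : Vec A n → ℤ) c → ext f (bd c) ≡ ext (δ f) c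
  ext-bd f c = trans (ext-linear f faces c) (ext-cong (ext-faces f) c)

  coef-bd : ∀ {n} c (t : Vec A n) → coef (bd c) t ≡ ext (δ (𝟙 t)) c
  coef-bd c t = trans (coef-ext _≟ⱽ_ (bd c) t) (ext-bd (𝟙 t) c)

  coef-bd-cong : ∀ {n} {c c′ : FormalSum (Vec A (suc n))} → c ≈ c′ → bd c ≈ bd c′
  coef-bd-cong {c = c} {c′} c≈c′ t = trans (coef-bd c t)
    (trans (ext-resp-≈ _≟ⱽ_ (δ (𝟙 t)) {c} {c′} c≈c′) (sym (coef-bd c′ t)))

  bd-bd : ∀ {n} (c : FormalSum (Vec A (suc (suc n)))) t → coef (bd (bd c)) t ≡ 0ℤ
  bd-bd c t = trans (coef-bd (bd c) t) (trans (ext-bd (δ (𝟙 t)) c) (ext-zero (δδ≡0 (𝟙 t)) c))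

  coef-minus : ∀ {n} (c d : FormalSum (Vec A n)) t → coef (c ++ negate d) t ≡ coef c t - coef d t
  coef-minus = coef-diff _≟ⱽ_

  coef-bd-++ : ∀ {n} (c d : FormalSum (Vec A (suc n))) t →
               coef (bd (c ++ d)) t ≡ coef (bd c) t + coef (bd d) t
  coef-bd-++ c d t = trans (coef-bd (c ++ d) t) (trans (ext-++ (δ (𝟙 t)) c d)
    (sym (cong₂ _+_ (coef-bd c t) (coef-bd d t))))

  coef-bd-minus : ∀ {n} (c d : FormalSum (Vec A (suc n))) t →
                  coef (bd (c ++ negate d)) t ≡ coef (bd c) t - coef (bd d) t
  coef-bd-minus c d t = trans (coef-bd-++ c (negate d) t) (cong (coef (bd c) t +_) (begin
    coef (bd (negate d)) t             ≡⟨ coef-bd (negate d) t ⟩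
    ext (δ (𝟙 t)) (negate d)           ≡⟨ ext-scale (δ (𝟙 t)) -1ℤ d ⟩
    -1ℤ * ext (δ (𝟙 t)) d              ≡⟨ ℤ.-1*i≡-i _ ⟩
    - ext (δ (𝟙 t)) d                  ≡⟨ cong -_ (coef-bd d t) ⟨
    - coef (bd d) t                    ∎))
    where open ≡-Reasoning

  SupportedOn : ∀ {n} → (Vec A n → Set) → FormalSum (Vec A n) → Set
  SupportedOn Q c = ∀ t → ¬ Q t → coef c t ≡ 0ℤ

  supported-bd : ∀ {n} {Q : Vec A (suc n) → Set} {R : Vec A n → Set} →
                 (∀ t → Dec (Q t)) → (∀ {t} → Q t → ∀ i → R (removeAt t i)) →
                 ∀ c → SupportedOn Q c → SupportedOn R (bd c)
  supported-bd Q? closed c c⊆Q t ¬Rt = trans (coef-bd c t) (ext-coef-zero _≟ⱽ_ (δ (𝟙 t)) c zero-term)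
    where
    zero-term : ∀ s → coef c s * δ (𝟙 t) s ≡ 0ℤ
    zero-term s with Q? s
    ... | no ¬Qs = trans (cong (_* δ (𝟙 t) s) (c⊆Q s ¬Qs)) (ℤ.*-zeroˡ (δ (𝟙 t) s))
    ... | yes Qs = trans (cong (coef c s *_) (∑-zero _ λ i → trans
                     (cong (sign i *_) (ind-≢ _≟ⱽ_ {t} {removeAt s i} λ { refl → ¬Rt (closed Qs i) }))
                     (ℤ.*-zeroʳ (sign i))))
                     (ℤ.*-zeroʳ (coef c s))

  -- Complexes spanned by some of the tuples, in which the boundary of a tuple consists of
  -- those of its faces that again belong to the complex.
  module Sub (Q      : ∀ {m} → Vec A (suc m) → Set)
             (Q?     : ∀ {m} (t : Vec A (suc m)) → Dec (Q t))
             (∂gen   : ∀ {m} → Refinement (Vec A (suc (suc m))) Q →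
                       FormalSum (Refinement (Vec A (suc m)) Q))
             (∂gen-δ : ∀ {m} (b : Refinement (Vec A (suc (suc m))) Q) b′ →
                       Coefficients.coef (≟-refinement _≟ⱽ_) (∂gen b) b′ ≡ δ (𝟙 (value b′)) (value b)) where

    C : FreeComplex
    C = record { Gen = λ m → Refinement (Vec A (suc m)) Q ; _≟_ = ≟-refinement _≟ⱽ_ ; ∂gen = ∂gen }

    open FreeComplex C public
      using (Gen; ∂; IsCycle; Cycle; cycle; chain; isCycle; _∼_; ≈⇒∼; _+ᶻ_; -ᶻ_; 0ᶻ)
      renaming (_≟_ to _≟ᴳ_; coef to coefᴳ; _≈_ to _≈ᴳ_)

    -- The proof stored in a generator is irrelevant; decidability recovers a usable one.
    Q! : ∀ {m} (b : Gen m) → Q (value b)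
    Q! (t , [ p ]) = recompute (Q? t) p

    element : ∀ {m} (t : Vec A (suc m)) → Q t → Gen m
    element t q = t , [ q ]

    include : ∀ {m} → FormalSum (Gen m) → FormalSum (Vec A (suc m))
    include = List.map λ (a , b) → a , value b

    restrict : ∀ {m} → FormalSum (Vec A (suc m)) → FormalSum (Gen m)
    restrict []            = []
    restrict ((a , t) ∷ c) with Q? t
    ... | yes q = (a , element t q) ∷ restrict c
    ... | no  _ = restrict c

    coef-include : ∀ {m} (c : FormalSum (Gen m)) b → coef (include c) (value b) ≡ coefᴳ c b
    coef-include []             b = refl
    coef-include ((a , b′) ∷ c) b =
      cong ((if does (value b′ ≟ⱽ value b) then a else 0ℤ) +_) (coef-include c b)

    ext-include : ∀ {m} f (c : FormalSum (Gen m)) → ext f (include c) ≡ ext (f ∘ value) c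
    ext-include f []            = refl
    ext-include f ((a , b) ∷ c) = cong (a * f (value b) +_) (ext-include f c)

    include-supported : ∀ {m} (c : FormalSum (Gen m)) → SupportedOn Q (include c)
    include-supported []            t ¬q = refl
    include-supported ((a , b) ∷ c) t ¬q
      rewrite dec-false (value b ≟ⱽ t) (λ { refl → ¬q (Q! b) }) =
      trans (ℤ.+-identityˡ _) (include-supported c t ¬q)

    coef-restrict : ∀ {m} (c : FormalSum (Vec A (suc m))) b → coefᴳ (restrict c) b ≡ coef c (value b)
    coef-restrict []            b = refl
    coef-restrict ((a , t) ∷ c) b with Q? t
    ... | yes q = cong ((if does (t ≟ⱽ value b) then a else 0ℤ) +_) (coef-restrict c b)
    ... | no ¬q rewrite dec-false (t ≟ⱽ value b) (λ { refl → ¬q (Q! b) }) =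
      trans (coef-restrict c b) (sym (ℤ.+-identityˡ _))

    coef-include-restrict : ∀ {m} (c : FormalSum (Vec A (suc m))) {t} → Q t →
                            coef (include (restrict c)) t ≡ coef c t
    coef-include-restrict c {t} q =
      trans (coef-include (restrict c) (element t q)) (coef-restrict c (element t q))

    include-restrict : ∀ {m} (c : FormalSum (Vec A (suc m))) → SupportedOn Q c → include (restrict c) ≈ c
    include-restrict c c⊆Q t with Q? t
    ... | yes q = coef-include-restrict c q
    ... | no ¬q = trans (include-supported (restrict c) t ¬q) (sym (c⊆Q t ¬q))

    include-≈ : ∀ {m} {c c′ : FormalSum (Gen m)} → c ≈ᴳ c′ → include c ≈ include c′
    include-≈ {c = c} {c′} c≈c′ t with Q? t
    ... | yes q = trans (coef-include c (element t q))
      (trans (c≈c′ (element t q)) (sym (coef-include c′ (element t q))))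
    ... | no ¬q = trans (include-supported c t ¬q) (sym (include-supported c′ t ¬q))

    -- Faces outside the complex are dropped on the left and never evaluated on the right, so the
    -- formula covers quotients such as `MC j` as well as subcomplexes.
    coef-∂ : ∀ {m} (c : FormalSum (Gen (suc m))) b → coefᴳ (∂ c) b ≡ coef (bd (include c)) (value b)
    coef-∂ c b = begin
      coefᴳ (∂ c) b                          ≡⟨ coef-ext _≟ᴳ_ (∂ c) b ⟩
      ext (ind _≟ᴳ_ b) (∂ c)                 ≡⟨ ext-linear (ind _≟ᴳ_ b) ∂gen c ⟩
      ext (λ x → ext (ind _≟ᴳ_ b) (∂gen x)) c
        ≡⟨ ext-cong (λ x → trans (sym (coef-ext _≟ᴳ_ (∂gen x) b)) (∂gen-δ x b)) c ⟩
      ext (δ (𝟙 (value b)) ∘ value) c        ≡⟨ ext-include (δ (𝟙 (value b))) c ⟨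
      ext (δ (𝟙 (value b))) (include c)      ≡⟨ coef-bd (include c) (value b) ⟨
      coef (bd (include c)) (value b)        ∎
      where open ≡-Reasoning

module SimplicialChains {A : Set} (_≟_ : DecidableEquality A) (K : OrderedComplex A)
                        (simplex? : ∀ {m} (t : Vec A (suc m)) → Dec (OrderedComplex.IsSimplex K t)) where
  open Ambient _≟_
  open OrderedComplex K

  private
    ∂gen-δ : ∀ {m} (b : Refinement (Vec A (suc (suc m))) IsSimplex) b′ →
      Coefficients.coef (≟-refinement _≟ⱽ_) (FreeComplex.∂gen (simplicialChains _≟_ K) b) b′ ≡
      δ (𝟙 (value b′)) (value b)
    ∂gen-δ b@(t , σ) b′ = begin
      Coefficients.coef _≟ᴳ_ (alternatingSum face) b′
        ≡⟨ coef-ext _≟ᴳ_ (alternatingSum face) b′ ⟩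
      ext (ind _≟ᴳ_ b′) (alternatingSum face)
        ≡⟨ ext-alternatingSum (ind _≟ᴳ_ b′) face ⟩
      ∑[ i < _ ] sign i * ext (ind _≟ᴳ_ b′) (face i)
        ≡⟨ sum-cong-≗ (λ i → cong (sign i *_) (trans (ℤ.+-identityʳ _)
             (ℤ.*-identityˡ (𝟙 (value b′) (removeAt t i))))) ⟩
      δ (𝟙 (value b′)) t ∎
      where
      open ≡-Reasoning
      _≟ᴳ_ = ≟-refinement {Q = IsSimplex} _≟ⱽ_
      face : ∀ i → FormalSum (Refinement (Vec A _) IsSimplex)
      face i = gen (removeAt t i , Irrelevant.map (λ s → face-closed s i) σ)

  open Sub IsSimplex simplex? (FreeComplex.∂gen (simplicialChains _≟_ K)) ∂gen-δ public

  -- Closure under faces enters here: the ambient boundary of a simplex has no term outside the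
  -- complex. For magnitude chains, whose boundary drops faces, only `coef-∂` is available.
  include-∂ : ∀ {m} (c : FormalSum (Gen (suc m))) → include (∂ c) ≈ bd (include c)
  include-∂ c t with simplex? t
  ... | yes q = trans (coef-include (∂ c) (element t q)) (coef-∂ c (element t q))
  ... | no ¬q = trans (include-supported (∂ c) t ¬q)
                  (sym (supported-bd simplex? face-closed (include c) (include-supported c) t ¬q))

module MagnitudeChains {n} (P : GradedPoset n) (k : ℕ) where
  open GradedPoset P hiding (H)
  open Ambient _≟_
  private
    module MC = FreeComplex (MC k)
    open MC using (∂gen)

    -- The face maps of MC are local to its definition, hence cannot be named. Their signed
    -- versions are recovered by unification, with _++_ made opaque by the with-abstraction so
    -- that the unifier can compare the two sums term by term.
    face : ∀ {m} → MC.Gen (suc m) → Fin (suc (suc m)) → FormalSum (MC.Gen m)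
    ∂gen-face : ∀ {m} (b : MC.Gen (suc m)) → ∂gen b ≡ concatMap (face b) (allFin _)
    face b = _
    ∂gen-face {m} b with List._++_ {A = ℤ × MC.Gen m}
    ... | _ = refl

    generator? : ∀ {m} (t : Vec Carrier (suc m)) → Dec (IsMagnitudeGenerator k t)
    generator? t = Linked.linked? (λ x y → ¬? (x ≟ y)) t
                   ×-dec Maybe.≡-dec ℕ._≟_ (L t) (just k)

    ext-face : ∀ {m} (b : MC.Gen (suc m)) b′ i →
               ext (ind MC._≟_ b′) (face b i) ≡ sign i * 𝟙 (value b′) (removeAt (value b) i)
    ext-face (t , g) b′@(t′ , [ g′ ]) i with Maybe.≡-dec ℕ._≟_ (L (removeAt t i)) (just k)
    ... | yes eq = trans (ℤ.+-identityʳ _)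
      (cong (_* 𝟙 (value b′) (removeAt t i)) (ℤ.*-identityʳ (sign i)))
    ... | no ¬eq = sym (trans (cong (sign i *_) (ind-≢ _≟ⱽ_ {t′} {removeAt t i} λ { refl → ¬eq length≡k }))
                              (ℤ.*-zeroʳ (sign i)))
      where
      length≡k : L t′ ≡ just k
      length≡k = recompute (Maybe.≡-dec ℕ._≟_ (L t′) (just k)) (proj₂ g′)

    ext-concatMap-allFin : ∀ {B : Set} {m} (f : B → ℤ) (F : Fin m → FormalSum B) →
                           ext f (concatMap F (allFin m)) ≡ ∑[ i < m ] ext f (F i)
    ext-concatMap-allFin {m = m} f F = go (λ i → i)
      where
      go : ∀ {l} (h : Fin l → Fin m) → ext f (concatMap F (List.tabulate h)) ≡ ∑[ i < l ] ext f (F (h i))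
      go {zero}  h = refl
      go {suc l} h = trans (ext-++ f (F (h zero)) _) (cong (ext f (F (h zero)) +_) (go (h ∘ suc)))

    ∂gen-δ : ∀ {m} (b : MC.Gen (suc m)) b′ → MC.coef (∂gen b) b′ ≡ δ (𝟙 (value b′)) (value b)
    ∂gen-δ b b′ = begin
      MC.coef (∂gen b) b′                                        ≡⟨ coef-ext MC._≟_ (∂gen b) b′ ⟩
      ext (ind MC._≟_ b′) (∂gen b)                               ≡⟨ cong (ext (ind MC._≟_ b′)) (∂gen-face b) ⟩
      ext (ind MC._≟_ b′) (concatMap (face b) (allFin _))        ≡⟨ ext-concatMap-allFin (ind MC._≟_ b′) (face b) ⟩
      ∑[ i < _ ] ext (ind MC._≟_ b′) (face b i)                  ≡⟨ sum-cong-≗ (ext-face b b′) ⟩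
      δ (𝟙 (value b′)) (value b)                                 ∎
      where open ≡-Reasoning

  open Sub (IsMagnitudeGenerator k) generator? ∂gen ∂gen-δ public

module SimplicialHomology {A : Set} (_≟_ : DecidableEquality A) (K : OrderedComplex A)
                          (simplex? : ∀ {m} (t : Vec A (suc m)) → Dec (OrderedComplex.IsSimplex K t)) where
  open Ambient _≟_
  open OrderedComplex K
  open SimplicialChains _≟_ K simplex? public

  AmbientCycle : ∀ {m} → FormalSum (Vec A (suc m)) → Set
  AmbientCycle {zero}  c = ⊤
  AmbientCycle {suc m} c = bd c ≈ []

  include-cycle : ∀ {m} (z : Cycle m) → AmbientCycle (include (chain z))
  include-cycle {zero}  z = tt
  include-cycle {suc m} z t =
    trans (sym (include-∂ (chain z) t)) (include-≈ {c = ∂ (chain z)} {[]} (isCycle z) t)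

  restrict-cycle : ∀ {m} (c : FormalSum (Vec A (suc m))) → SupportedOn IsSimplex c →
                   AmbientCycle c → IsCycle (restrict c)
  restrict-cycle {zero}  c c⊆K z   = tt
  restrict-cycle {suc m} c c⊆K z b = trans (coef-∂ (restrict c) b)
    (trans (coef-bd-cong {c = include (restrict c)} {c} (include-restrict c c⊆K) (value b)) (z (value b)))

  ∼⇒bounds : ∀ {m} {x y : Cycle m} → x ∼ y →
    ∃[ e ] SupportedOn IsSimplex e × bd e ≈ include (chain x) ++ negate (include (chain y))
  ∼⇒bounds {x = x} {y} (b , eq) = include b , include-supported b , λ t → begin
    coef (bd (include b)) t
      ≡⟨ include-∂ b t ⟨
    coef (include (∂ b)) t
      ≡⟨ include-≈ {c = ∂ b} {chain x ++ negate (chain y)} eq t ⟩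
    coef (include (chain x ++ negate (chain y))) t
      ≡⟨ coef-ext _≟ⱽ_ (include (chain x ++ negate (chain y))) t ⟩
    ext (𝟙 t) (include (chain x ++ negate (chain y)))
      ≡⟨ ext-include (𝟙 t) (chain x ++ negate (chain y)) ⟩
    ext (𝟙 t ∘ value) (chain x ++ negate (chain y))
      ≡⟨ trans (ext-++ _ (chain x) _) (cong (ext (𝟙 t ∘ value) (chain x) +_)
           (trans (ext-scale _ -1ℤ (chain y)) (ℤ.-1*i≡-i (ext (𝟙 t ∘ value) (chain y))))) ⟩
    ext (𝟙 t ∘ value) (chain x) - ext (𝟙 t ∘ value) (chain y)
      ≡⟨ cong₂ _-_ (ext-include (𝟙 t) (chain x)) (ext-include (𝟙 t) (chain y)) ⟨
    ext (𝟙 t) (include (chain x)) - ext (𝟙 t) (include (chain y))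
      ≡⟨ cong₂ _-_ (coef-ext _≟ⱽ_ (include (chain x)) t) (coef-ext _≟ⱽ_ (include (chain y)) t) ⟨
    coef (include (chain x)) t - coef (include (chain y)) t
      ≡⟨ coef-minus (include (chain x)) (include (chain y)) t ⟨
    coef (include (chain x) ++ negate (include (chain y))) t ∎
    where open ≡-Reasoning

  bounds⇒∼ : ∀ {m} {x y : Cycle m} e → SupportedOn IsSimplex e →
    bd e ≈ include (chain x) ++ negate (include (chain y)) → x ∼ y
  bounds⇒∼ {x = x} {y} e e⊆K eq = restrict e , λ b → begin
    coefᴳ (∂ (restrict e)) b
      ≡⟨ coef-∂ (restrict e) b ⟩
    coef (bd (include (restrict e))) (value b)
      ≡⟨ coef-bd-cong {c = include (restrict e)} {e} (include-restrict e e⊆K) (value b) ⟩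
    coef (bd e) (value b)
      ≡⟨ trans (eq (value b)) (coef-minus (include (chain x)) (include (chain y)) (value b)) ⟩
    coef (include (chain x)) (value b) - coef (include (chain y)) (value b)
      ≡⟨ cong₂ _-_ (coef-include (chain x) b) (coef-include (chain y) b) ⟩
    coefᴳ (chain x) b - coefᴳ (chain y) b
      ≡⟨ coef-diff _≟ᴳ_ (chain x) (chain y) b ⟨
    coefᴳ (chain x ++ negate (chain y)) b ∎
    where open ≡-Reasoning

-- The filtration of Δ by rank span

module RankFiltration {n} (P : GradedPoset n) where
  open GradedPoset P hiding (H)
  open Ambient _≟_

  rank-growth : ∀ {m} {t : Vec Carrier (suc m)} → Linked _<_ t →
                m ℕ.+ r (lookup t zero) ℕ.≤ r (lookup t (fromℕ m))
  rank-growth {t = x ∷ []} [-] = ℕ.≤-refl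
  rank-growth {suc m} {x ∷ y ∷ t} (x<y ∷ l) = ℕ.≤-trans
    (subst (ℕ._≤ m ℕ.+ r y) (ℕ.+-suc m (r x)) (ℕ.+-monoʳ-≤ m (r-mono-< x<y))) (rank-growth l)

  rank-ends : ∀ {m} {t : Vec Carrier (suc m)} → Linked _<_ t → r (lookup t zero) ℕ.≤ r (lookup t (fromℕ m))
  rank-ends {m} l = ℕ.≤-trans (ℕ.m≤n+m _ m) (rank-growth l)

  length≤rankSpan : ∀ {m} {t : Vec Carrier (suc m)} → Linked _<_ t → m ℕ.≤ rankSpan t
  length≤rankSpan {m} l = ℕ.m+n≤o⇒m≤o∸n m (rank-growth l)

  rankSpan≤n : ∀ {m} (t : Vec Carrier (suc m)) → rankSpan t ℕ.≤ n
  rankSpan≤n {m} t = ℕ.≤-trans (ℕ.m∸n≤m (r (lookup t (fromℕ m))) (r (lookup t zero))) (r≤n _)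

  -- The rank differences of consecutive vertices telescope. Hence the generators of `MC j` are the
  -- chains of rank span j.
  L-chain : ∀ {m} {t : Vec Carrier (suc m)} → Linked _<_ t → L t ≡ just (rankSpan t)
  L-chain {t = x ∷ []} [-] = cong just (sym (ℕ.n∸n≡0 (r x)))
  L-chain {suc m} {x ∷ y ∷ t} (x<y ∷ l)
    rewrite dec-true (x ≤? y) (proj₁ x<y) | L-chain l = cong just (begin
      (r y ℕ.∸ r x) ℕ.+ (z ℕ.∸ r y)  ≡⟨ ℕ.+-comm (r y ℕ.∸ r x) _ ⟩
      (z ℕ.∸ r y) ℕ.+ (r y ℕ.∸ r x)  ≡⟨ ℕ.+-∸-assoc (z ℕ.∸ r y) (r-mono-≤ (proj₁ x<y)) ⟨
      (z ℕ.∸ r y) ℕ.+ r y ℕ.∸ r x    ≡⟨ cong (ℕ._∸ r x) (ℕ.m∸n+n≡m (rank-ends l)) ⟩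
      z ℕ.∸ r x                      ∎)
    where
    open ≡-Reasoning
    z = r (lookup (y ∷ t) (fromℕ m))

  generator⇒span : ∀ {k m} {t : Vec Carrier (suc m)} → IsMagnitudeGenerator k t →
                   Linked _<_ t × rankSpan t ≡ k
  generator⇒span g@(_ , eq) =
    generator-increasing g , Maybe.just-injective (trans (sym (L-chain (generator-increasing g))) eq)

  span⇒generator : ∀ {k m} {t : Vec Carrier (suc m)} → Linked _<_ t → rankSpan t ≡ k →
                   IsMagnitudeGenerator k t
  span⇒generator l eq = Linked.map proj₂ l , trans (L-chain l) (cong just eq)

  -- Strictly below j, so that the filtration starts with the empty complex.
  Within : ℕ → ∀ {m} → Vec Carrier (suc m) → Set
  Within j t = Linked _<_ t × rankSpan t ℕ.< j

  linked? : ∀ {m} (t : Vec Carrier m) → Dec (Linked _<_ t)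
  linked? = Linked.linked? _<?_

  within? : ∀ j {m} (t : Vec Carrier (suc m)) → Dec (Within j t)
  within? j t = linked? t ×-dec (rankSpan t ℕ.<? j)

  within-closed : ∀ {j m} {t : Vec Carrier (suc (suc m))} → Within j t → ∀ i → Within j (removeAt t i)
  within-closed (l , p) i = removeAt-linked <-trans l i , ℕ.≤-<-trans (rankSpan-removeAt l i) p

  within-suc : ∀ {j m} {t : Vec Carrier (suc m)} → ¬ Within j t → Within (suc j) t →
               IsMagnitudeGenerator j t
  within-suc {j} ¬w (l , s≤s p) = span⇒generator l (ℕ.≤-antisym p (ℕ.≮⇒≥ λ q → ¬w (l , q)))

  generator-within : ∀ {j m} {t : Vec Carrier (suc m)} → IsMagnitudeGenerator j t → Within (suc j) t
  generator-within g with generator⇒span g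
  ... | l , refl = l , ℕ.≤-refl

  generator-not-within : ∀ {j m} {t : Vec Carrier (suc m)} → IsMagnitudeGenerator j t → ¬ Within j t
  generator-not-within g (_ , p) = ℕ.<-irrefl (proj₂ (generator⇒span g)) p

  Supp : ℕ → ∀ {m} → FormalSum (Vec Carrier (suc m)) → Set
  Supp j = SupportedOn (Within j)

  supp-mono : ∀ {i j m} (c : FormalSum (Vec Carrier (suc m))) → i ℕ.≤ j → Supp i c → Supp j c
  supp-mono c i≤j p t ¬w = p t λ (l , q) → ¬w (l , ℕ.<-≤-trans q i≤j)

  supp-≈ : ∀ {j m} {c c′ : FormalSum (Vec Carrier (suc m))} → c ≈ c′ → Supp j c → Supp j c′
  supp-≈ c≈c′ p t ¬w = trans (sym (c≈c′ t)) (p t ¬w)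

  supp-bd : ∀ {j m} (c : FormalSum (Vec Carrier (suc (suc m)))) → Supp j c → Supp j (bd c)
  supp-bd {j} = supported-bd (within? j) within-closed

  supp-minus : ∀ {j m} (c d : FormalSum (Vec Carrier (suc m))) → Supp j c → Supp j d →
               Supp j (c ++ negate d)
  supp-minus c d p q t ¬w = trans (coef-minus c d t) (cong₂ _-_ (p t ¬w) (q t ¬w))

  BoundaryWithin : ℕ → ∀ {m} → FormalSum (Vec Carrier (suc m)) → Set
  BoundaryWithin j {zero}  c = ⊤
  BoundaryWithin j {suc m} c = Supp j (bd c)

  module TopPart (j : ℕ) where
    module M = MagnitudeChains P j

    top : ∀ {m} → FormalSum (Vec Carrier (suc m)) → FormalSum (Vec Carrier (suc m))
    top c = M.include (M.restrict c)

    minus-top : ∀ {m} (c : FormalSum (Vec Carrier (suc m))) → Supp (suc j) c →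
                Supp j (c ++ negate (top c))
    minus-top c p t ¬w = trans (coef-minus c (top c) t) (by-cases (within? (suc j) t))
      where
      by-cases : Dec (Within (suc j) t) → coef c t - coef (top c) t ≡ 0ℤ
      by-cases (yes w) = ℤ.i≡j⇒i-j≡0 (sym (M.coef-include-restrict c (within-suc ¬w w)))
      by-cases (no ¬w′) = cong₂ _-_ (p t ¬w′)
        (M.include-supported (M.restrict c) t (¬w′ ∘ generator-within))

    -- The difference of `c` and `top c` has span below j, and faces do not increase the span, so
    -- its boundary has no coefficient at a tuple of span j.
    bd-top : ∀ {m} (c : FormalSum (Vec Carrier (suc (suc m)))) → Supp (suc j) c →
             ∀ {t} → IsMagnitudeGenerator j t → coef (bd (top c)) t ≡ coef (bd c) t
    bd-top c p {t} g = sym (ℤ.i-j≡0⇒i≡j (coef (bd c) t) _ (trans (sym (coef-bd-minus c (top c) t))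
      (supp-bd (c ++ negate (top c)) (minus-top c p) t (generator-not-within g))))

    restrict-cycle : ∀ {m} (c : FormalSum (Vec Carrier (suc m))) → Supp (suc j) c → BoundaryWithin j c →
                     M.IsCycle (M.restrict c)
    restrict-cycle {zero}  c p q   = tt
    restrict-cycle {suc m} c p q b = trans (M.coef-∂ (M.restrict c) b)
      (trans (bd-top c p (M.Q! b)) (q (value b) (generator-not-within (M.Q! b))))

    -- The faces dropped by the magnitude boundary have span below j, and so do their own faces;
    -- they cannot contribute to a coefficient of span j. The claim thus reduces to `bd-bd`.
    ∂-∂ : ∀ {m} (c : FormalSum (M.Gen (suc (suc m)))) → M.∂ (M.∂ c) M.≈ᴳ []
    ∂-∂ c b = begin
      M.coefᴳ (M.∂ (M.∂ c)) b
        ≡⟨ M.coef-∂ (M.∂ c) b ⟩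
      coef (bd (M.include (M.∂ c))) (value b)
        ≡⟨ coef-bd-cong {c = M.include (M.∂ c)} {top (bd (M.include c))}
             (M.include-≈ {c = M.∂ c} {M.restrict (bd (M.include c))} λ x →
               trans (M.coef-∂ c x) (sym (M.coef-restrict (bd (M.include c)) x))) (value b) ⟩
      coef (bd (top (bd (M.include c)))) (value b)
        ≡⟨ bd-top (bd (M.include c)) (supp-bd (M.include c) λ t ¬w →
             M.include-supported c t (¬w ∘ generator-within)) (M.Q! b) ⟩
      coef (bd (bd (M.include c))) (value b)
        ≡⟨ bd-bd (M.include c) (value b) ⟩
      0ℤ ∎
      where open ≡-Reasoning

    -- The part of c of span j is a cycle of MC j, hence a boundary there.
    push : ∀ {m} → Trivial (MH j m) → (c : FormalSum (Vec Carrier (suc m))) →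
           Supp (suc j) c → BoundaryWithin j c →
           ∃[ e ] Supp (suc j) e × Supp j (c ++ negate (bd e))
    push triv c p q with triv (M.cycle (M.restrict c) (restrict-cycle c p q))
    ... | b , eq = e , e-supp , λ t ¬w →
      trans (coef-minus c (bd e) t) (by-cases t ¬w (within? (suc j) t))
      where
      open ≡-Reasoning
      e = M.include b
      e-supp : Supp (suc j) e
      e-supp t ¬w = M.include-supported b t (¬w ∘ generator-within)
      by-cases : ∀ t → ¬ Within j t → Dec (Within (suc j) t) → coef c t - coef (bd e) t ≡ 0ℤ
      by-cases t ¬w (no ¬w′) = cong₂ _-_ (p t ¬w′) (supp-bd e e-supp t ¬w′)
      by-cases t ¬w (yes w)  = ℤ.i≡j⇒i-j≡0 (begin
        coef c t                                ≡⟨ M.coef-restrict c x ⟨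
        M.coefᴳ (M.restrict c) x                ≡⟨ cong (λ c′ → M.coefᴳ c′ x) (List.++-identityʳ (M.restrict c)) ⟨
        M.coefᴳ (M.restrict c ++ []) x          ≡⟨ eq x ⟨
        M.coefᴳ (M.∂ b) x                       ≡⟨ M.coef-∂ b x ⟩
        coef (bd e) t                           ∎)
        where x = M.element t (within-suc ¬w w)

  -- Comparison of the homology of `Δ⟨ k ⟩` and `Δ`

  module _ (diagonal : Diagonal) (k : ℕ) where

    -- `d` measures how far the span of `c` may exceed k. The stage j = k + suc d is removed by
    -- `push`, since m ≤ k < j makes `MH j m` trivial. Subtracting `bd e` leaves the boundary of `c`
    -- unchanged, so the next stage can be treated in the same way. Degree k itself is included, for
    -- the bounding chains in the proof of injectivity.
    compress : ∀ d {m} → m ℕ.≤ k → (c : FormalSum (Vec Carrier (suc m))) →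
               Supp (suc (k ℕ.+ d)) c → BoundaryWithin (suc k) c →
               ∃[ e ] Supp (suc (k ℕ.+ d)) e × Supp (suc k) (c ++ negate (bd e))
    compress zero m≤k c p q = [] , (λ _ _ → refl) , λ t ¬w →
      trans (coef-minus c [] t) (trans (ℤ.+-identityʳ (coef c t))
        (p t λ (l , s) → ¬w (l , subst (λ j → rankSpan t ℕ.< suc j) (ℕ.+-identityʳ k) s)))
    compress (suc d) {m} m≤k c p q = step
      (TopPart.push j (diagonal j m m≢j) c p (mono c q))
      where
      open ≡-Reasoning
      j = k ℕ.+ suc d
      k<j : k ℕ.< j
      k<j = ℕ.m<m+n k (s≤s z≤n)
      m≢j : m ≢ j
      m≢j = ℕ.<⇒≢ (ℕ.≤-<-trans m≤k k<j)
      mono : ∀ {m} (c : FormalSum (Vec Carrier (suc m))) → BoundaryWithin (suc k) c → BoundaryWithin j c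
      mono {zero}  c q = tt
      mono {suc m} c q = supp-mono (bd c) k<j q
      after : ∀ {m} (c : FormalSum (Vec Carrier (suc m))) e → BoundaryWithin (suc k) c →
              BoundaryWithin (suc k) (c ++ negate (bd e))
      after {zero}  c e q = tt
      after {suc m} c e q t ¬w = trans (coef-bd-minus c (bd e) t) (cong₂ _-_ (q t ¬w) (bd-bd e t))
      step : ∃[ e ] Supp (suc j) e × Supp j (c ++ negate (bd e)) →
             ∃[ e ] Supp (suc j) e × Supp (suc k) (c ++ negate (bd e))
      step (e₁ , p₁ , q₁)
        with compress d m≤k (c ++ negate (bd e₁))
               (subst (λ i → Supp i (c ++ negate (bd e₁))) (ℕ.+-suc k d) q₁) (after c e₁ q)
      ... | e₂ , p₂ , q₂ = e₁ ++ e₂ , e-supp , λ t ¬w → begin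
        coef (c ++ negate (bd (e₁ ++ e₂))) t
          ≡⟨ trans (coef-minus c (bd (e₁ ++ e₂)) t) (cong (λ u → coef c t - u) (coef-bd-++ e₁ e₂ t)) ⟩
        coef c t - (coef (bd e₁) t + coef (bd e₂) t)
          ≡⟨ lemma (coef c t) (coef (bd e₁) t) (coef (bd e₂) t) ⟩
        coef c t - coef (bd e₁) t - coef (bd e₂) t
          ≡⟨ trans (coef-minus (c ++ negate (bd e₁)) (bd e₂) t)
               (cong (λ u → u - coef (bd e₂) t) (coef-minus c (bd e₁) t)) ⟨
        coef ((c ++ negate (bd e₁)) ++ negate (bd e₂)) t
          ≡⟨ q₂ t ¬w ⟩
        0ℤ ∎
        where
        lemma : ∀ x y z → x - (y + z) ≡ x - y - z
        lemma = solve-∀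
        e-supp : Supp (suc j) (e₁ ++ e₂)
        e-supp t ¬w = trans (coef-++ e₁ e₂ t) (cong₂ _+_ (p₁ t ¬w)
          (supp-mono e₂ (s≤s (ℕ.+-monoʳ-≤ k (ℕ.n≤1+n d))) p₂ t ¬w))

    module _ (k≤n : k ℕ.≤ n) where
      private
        module D = SimplicialHomology _≟_ Δ linked?
        module Dₖ = SimplicialHomology _≟_ Δ⟨ k ⟩ (λ t → linked? t ×-dec (rankSpan t ℕ.≤? k))

        -- No span exceeds n, so the stage k + (n - k) of the filtration is all of `Δ`.
        linked⇒within : ∀ {m} {t : Vec Carrier (suc m)} → Linked _<_ t → Within (suc (k ℕ.+ (n ℕ.∸ k))) t
        linked⇒within {t = t} l = l ,
          s≤s (subst (rankSpan t ℕ.≤_) (sym (ℕ.m+[n∸m]≡n k≤n)) (rankSpan≤n t))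

        Δ⇒supp : ∀ {m} (c : FormalSum (Vec Carrier (suc m))) →
                 SupportedOn (Linked _<_) c → Supp (suc (k ℕ.+ (n ℕ.∸ k))) c
        Δ⇒supp c p t ¬w = p t (¬w ∘ linked⇒within)

        supp⇒Δ : ∀ {j m} (c : FormalSum (Vec Carrier (suc m))) → Supp j c → SupportedOn (Linked _<_) c
        supp⇒Δ c p t ¬l = p t (¬l ∘ proj₁)

        Δₖ⇒supp : ∀ {m} (c : FormalSum (Vec Carrier (suc m))) →
                  SupportedOn (OrderedComplex.IsSimplex Δ⟨ k ⟩) c → Supp (suc k) c
        Δₖ⇒supp c p t ¬w = p t λ (l , s) → ¬w (l , s≤s s)

        supp⇒Δₖ : ∀ {m} (c : FormalSum (Vec Carrier (suc m))) →
                  Supp (suc k) c → SupportedOn (OrderedComplex.IsSimplex Δ⟨ k ⟩) c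
        supp⇒Δₖ c p t ¬s = p t λ { (l , s≤s s) → ¬s (l , s) }

        includeₖ : ∀ {m} → Dₖ.Cycle m → FormalSum (Vec Carrier (suc m))
        includeₖ z = Dₖ.include (Dₖ.chain z)

        includeₖ⊆Δₖ : ∀ {m} (z : Dₖ.Cycle m) → Supp (suc k) (includeₖ z)
        includeₖ⊆Δₖ z = Δₖ⇒supp (includeₖ z) (Dₖ.include-supported (Dₖ.chain z))

        includeₖ⊆Δ : ∀ {m} (z : Dₖ.Cycle m) → SupportedOn (Linked _<_) (includeₖ z)
        includeₖ⊆Δ z = supp⇒Δ (includeₖ z) (includeₖ⊆Δₖ z)

        inclusion : ∀ {m} → Dₖ.Cycle m → D.Cycle m
        inclusion z = D.cycle (D.restrict (includeₖ z))
          (D.restrict-cycle (includeₖ z) (includeₖ⊆Δ z) (recast (Dₖ.include-cycle z)))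
          where
          recast : ∀ {m} {c : FormalSum (Vec Carrier (suc m))} → Dₖ.AmbientCycle c → D.AmbientCycle c
          recast {zero}  p = tt
          recast {suc m} p = p

        include-inclusion : ∀ {m} (z : Dₖ.Cycle m) → D.include (D.chain (inclusion z)) ≈ includeₖ z
        include-inclusion z = D.include-restrict (includeₖ z) (includeₖ⊆Δ z)

        minus-cong : ∀ {m} {c c′ d d′ : FormalSum (Vec Carrier (suc m))} → c ≈ c′ → d ≈ d′ →
                     c ++ negate d ≈ c′ ++ negate d′
        minus-cong {c = c} {c′} {d} {d′} p q t =
          trans (coef-minus c d t) (trans (cong₂ _-_ (p t) (q t)) (sym (coef-minus c′ d′ t)))

        difference : ∀ {m} (x y : Dₖ.Cycle m) →
          D.include (D.chain (inclusion x)) ++ negate (D.include (D.chain (inclusion y))) ≈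
          includeₖ x ++ negate (includeₖ y)
        difference x y = minus-cong
          {c = D.include (D.chain (inclusion x))} {includeₖ x}
          {D.include (D.chain (inclusion y))} {includeₖ y}
          (include-inclusion x) (include-inclusion y)

        inclusion-cong : ∀ {m} {x y : Dₖ.Cycle m} → x Dₖ.∼ y → inclusion x D.∼ inclusion y
        inclusion-cong {x = x} {y} x∼y with Dₖ.∼⇒bounds {x = x} {y} x∼y
        ... | e , e⊆ , eq = D.bounds⇒∼ {x = inclusion x} {inclusion y} e
          (supp⇒Δ e (Δₖ⇒supp e e⊆)) λ t → trans (eq t) (sym (difference x y t))

        -- If `e` bounds x - y in `Δ`, then `e - bd e′` has the same boundary and, for a suitable
        -- `e′`, lies in `Δ⟨ k ⟩`. As `e` has degree m + 1, the bound on the degree in `compress`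
        -- reads m < k.
        inclusion-injective : ∀ {m} → m ℕ.< k → {x y : Dₖ.Cycle m} →
                              inclusion x D.∼ inclusion y → x Dₖ.∼ y
        inclusion-injective m<k {x} {y} fx∼fy with D.∼⇒bounds {x = inclusion x} {inclusion y} fx∼fy
        ... | e , e⊆ , eq with compress (n ℕ.∸ k) m<k e (Δ⇒supp e e⊆) (supp-≈
                {c = includeₖ x ++ negate (includeₖ y)} {bd e}
                (λ t → sym (trans (eq t) (difference x y t)))
                (supp-minus (includeₖ x) (includeₖ y) (includeₖ⊆Δₖ x) (includeₖ⊆Δₖ y)))
        ... | e′ , _ , e-e′ = Dₖ.bounds⇒∼ {x = x} {y} (e ++ negate (bd e′))
          (supp⇒Δₖ (e ++ negate (bd e′)) e-e′) λ t →
            trans (coef-bd-minus e (bd e′) t) (trans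
              (cong₂ _-_ (trans (eq t) (difference x y t)) (bd-bd e′ t))
              (ℤ.+-identityʳ _))

        -- The cycle itself is compressed: `y - bd e` lies in `Δ⟨ k ⟩` and is homologous to `y`
        -- through `e`.
        inclusion-surjective : ∀ {m} → m ℕ.< k → (y : D.Cycle m) → ∃[ x ] y D.∼ inclusion x
        inclusion-surjective {m} m<k y
          with compress (n ℕ.∸ k) (ℕ.<⇒≤ m<k) (D.include (D.chain y))
                 (Δ⇒supp (D.include (D.chain y)) (D.include-supported (D.chain y)))
                 (boundaryless (D.include (D.chain y)) (D.include-cycle y))
          where
          boundaryless : ∀ {m} (c : FormalSum (Vec Carrier (suc m))) →
                         D.AmbientCycle c → BoundaryWithin (suc k) c
          boundaryless {zero}  c p      = tt
          boundaryless {suc m} c p t ¬w = p t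
        ... | e , e⊆ , c-supp = x , D.bounds⇒∼ {x = y} {inclusion x} e (supp⇒Δ e e⊆) λ t → begin
          coef (bd e) t
            ≡⟨ lemma (coef (D.include (D.chain y)) t) (coef (bd e) t) ⟩
          coef (D.include (D.chain y)) t - (coef (D.include (D.chain y)) t - coef (bd e) t)
            ≡⟨ cong (λ u → coef (D.include (D.chain y)) t - u)
                 (trans (sym (coef-minus (D.include (D.chain y)) (bd e) t))
                 (trans (sym (Dₖ.include-restrict c (supp⇒Δₖ c c-supp) t)) (sym (include-inclusion x t)))) ⟩
          coef (D.include (D.chain y)) t - coef (D.include (D.chain (inclusion x))) t
            ≡⟨ coef-minus (D.include (D.chain y)) (D.include (D.chain (inclusion x))) t ⟨
          coef (D.include (D.chain y) ++ negate (D.include (D.chain (inclusion x)))) t ∎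
          where
          open ≡-Reasoning
          lemma : ∀ u v → v ≡ u - (u - v)
          lemma = solve-∀
          c : FormalSum (Vec Carrier (suc m))
          c = D.include (D.chain y) ++ negate (bd e)
          c-cycle : ∀ {m} (z : FormalSum (Vec Carrier (suc m))) e →
                    D.AmbientCycle z → Dₖ.AmbientCycle (z ++ negate (bd e))
          c-cycle {zero}  z e p   = tt
          c-cycle {suc m} z e p t = trans (coef-bd-minus z (bd e) t) (cong₂ _-_ (p t) (bd-bd e t))
          x : Dₖ.Cycle m
          x = Dₖ.cycle (Dₖ.restrict c) (Dₖ.restrict-cycle c (supp⇒Δₖ c c-supp)
            (c-cycle (D.include (D.chain y)) e (D.include-cycle y)))

        module HΔ {m : ℕ} = AbelianGroup (GradedPoset.H P m Δ)

        inclusion-homo : ∀ {m} (x y : Dₖ.Cycle m) →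
                         inclusion (x Dₖ.+ᶻ y) D.∼ inclusion x D.+ᶻ inclusion y
        inclusion-homo x y = D.≈⇒∼ (inclusion (x Dₖ.+ᶻ y)) (inclusion x D.+ᶻ inclusion y) λ b → begin
          D.coefᴳ (D.restrict (includeₖ (x Dₖ.+ᶻ y))) b
            ≡⟨ D.coef-restrict (includeₖ (x Dₖ.+ᶻ y)) b ⟩
          coef (includeₖ (x Dₖ.+ᶻ y)) (value b)
            ≡⟨ cong (λ c → coef c (value b)) (List.map-++ _ (Dₖ.chain x) (Dₖ.chain y)) ⟩
          coef (includeₖ x ++ includeₖ y) (value b)
            ≡⟨ coef-++ (includeₖ x) (includeₖ y) (value b) ⟩
          coef (includeₖ x) (value b) + coef (includeₖ y) (value b)
            ≡⟨ cong₂ _+_ (D.coef-restrict (includeₖ x) b) (D.coef-restrict (includeₖ y) b) ⟨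
          D.coefᴳ (D.chain (inclusion x)) b + D.coefᴳ (D.chain (inclusion y)) b
            ≡⟨ Coefficients.coef-++ D._≟ᴳ_ (D.chain (inclusion x)) (D.chain (inclusion y)) b ⟨
          D.coefᴳ (D.chain (inclusion x D.+ᶻ inclusion y)) b ∎
          where open ≡-Reasoning

        inclusion-neg : ∀ {m} (x : Dₖ.Cycle m) → inclusion (Dₖ.-ᶻ x) D.∼ D.-ᶻ inclusion x
        inclusion-neg x = D.≈⇒∼ (inclusion (Dₖ.-ᶻ x)) (D.-ᶻ inclusion x) λ b → begin
          D.coefᴳ (D.restrict (includeₖ (Dₖ.-ᶻ x))) b
            ≡⟨ D.coef-restrict (includeₖ (Dₖ.-ᶻ x)) b ⟩
          coef (Dₖ.include (negate (Dₖ.chain x))) (value b)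
            ≡⟨ cong (λ c → coef c (value b))
                 (trans (sym (List.map-∘ (Dₖ.chain x))) (List.map-∘ (Dₖ.chain x))) ⟩
          coef (negate (includeₖ x)) (value b)
            ≡⟨ coef-negate (includeₖ x) (value b) ⟩
          - coef (includeₖ x) (value b)
            ≡⟨ cong -_ (D.coef-restrict (includeₖ x) b) ⟨
          - D.coefᴳ (D.chain (inclusion x)) b
            ≡⟨ Coefficients.coef-negate D._≟ᴳ_ (D.chain (inclusion x)) b ⟨
          D.coefᴳ (D.chain (D.-ᶻ inclusion x)) b ∎
          where open ≡-Reasoning

      homology-iso : ∀ i → i ℕ.< k → GradedPoset.H P i Δ⟨ k ⟩ ≅ GradedPoset.H P i Δ
      homology-iso i i<k = inclusion , record
        { isGroupMonomorphism = record
          { isGroupHomomorphism = record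
            { isMonoidHomomorphism = record
              { isMagmaHomomorphism = record
                { isRelHomomorphism = record { cong = λ {x} {y} → inclusion-cong {x = x} {y} }
                ; homo = inclusion-homo
                }
              ; ε-homo = D.≈⇒∼ (inclusion Dₖ.0ᶻ) D.0ᶻ λ _ → refl
              }
            ; ⁻¹-homo = inclusion-neg
            }
          ; injective = λ {x} {y} → inclusion-injective i<k {x} {y}
          }
        ; surjective = λ y → let x , y∼fx = inclusion-surjective i<k y in
            x , λ {z} z∼x → HΔ.trans {_} {inclusion z} {inclusion x} {y} (inclusion-cong {x = z} {x} z∼x)
                              (HΔ.sym {_} {y} {inclusion x} y∼fx)
        }

-- Counting chains

module _ {A : Set} where

  unique⇒lookup-injective : ∀ {xs : List A} → Unique xs →
                            ∀ {i j} → List.lookup xs i ≡ List.lookup xs j → i ≡ j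
  unique⇒lookup-injective (x∉ ∷ u) {zero}  {zero}  eq = refl
  unique⇒lookup-injective (x∉ ∷ u) {zero}  {suc j} eq = contradiction eq (All.lookup x∉ (∈-lookup j))
  unique⇒lookup-injective (x∉ ∷ u) {suc i} {zero}  eq = contradiction (sym eq) (All.lookup x∉ (∈-lookup i))
  unique⇒lookup-injective (x∉ ∷ u) {suc i} {suc j} eq = cong suc (unique⇒lookup-injective u eq)

  unique-concatMap : ∀ {B : Set} (f : A → List B) → (∀ x → Unique (f x)) →
                     (∀ {x y v} → v ∈ f x → v ∈ f y → x ≡ y) →
                     ∀ {xs} → Unique xs → Unique (concatMap f xs)
  unique-concatMap f f-unique f-disjoint {xs} u = Unique.concat⁺
    (All.map⁺ (All.universal f-unique xs))
    (AllPairs.map⁺ (AllPairs.map (λ x≢y {_} (v∈x , v∈y) → x≢y (f-disjoint v∈x v∈y)) u))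

  -- A generator holds its proof irrelevantly, so its position in the list is found by deciding
  -- membership. Uniqueness of the entries makes that position the right one.
  refinement↔Fin : DecidableEquality A → ∀ {xs : List A} {Q : A → Set} → Unique xs →
                   (∀ {v} → v ∈ xs → Q v) → (∀ {v} → Q v → v ∈ xs) → Refinement A Q ↔ Fin (length xs)
  refinement↔Fin _≟_ {xs} {Q} u sound complete = mk↔ₛ′ to from to∘from from∘to
    where
    open DecMembership _≟_ using (_∈?_)
    member : (b : Refinement A Q) → value b ∈ xs
    member (v , [ q ]) = recompute (v ∈? xs) (complete q)
    to : Refinement A Q → Fin (length xs)
    to b = Any.index (member b)
    from : Fin (length xs) → Refinement A Q
    from i = List.lookup xs i , [ sound (∈-lookup i) ]
    from∘to : ∀ b → from (to b) ≡ b
    from∘to b = value-injective (sym (Any.lookup-index (member b)))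
    to∘from : ∀ i → to (from i) ≡ i
    to∘from i = unique⇒lookup-injective u (sym (Any.lookup-index (member (from i))))

listSum : ∀ {A : Set} → (A → ℤ) → List A → ℤ
listSum f xs = List.foldr _+_ 0ℤ (List.map f xs)

module _ {A : Set} where
  open ≡-Reasoning

  listSum-cong : ∀ {f g : A → ℤ} xs → (∀ {x} → x ∈ xs → f x ≡ g x) → listSum f xs ≡ listSum g xs
  listSum-cong []       eq = refl
  listSum-cong (x ∷ xs) eq = cong₂ _+_ (eq (here refl)) (listSum-cong xs (eq ∘ there))

  listSum-filter : ∀ {Q : Pred A 0ℓ} (Q? : Decidable Q) (f : A → ℤ) xs →
    listSum f (filter Q? xs) ≡ listSum (λ x → if does (Q? x) then f x else 0ℤ) xs
  listSum-filter Q? f []       = refl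
  listSum-filter Q? f (x ∷ xs) with does (Q? x)
  ... | true  = cong (f x +_) (listSum-filter Q? f xs)
  ... | false = trans (listSum-filter Q? f xs) (sym (ℤ.+-identityˡ _))

  listSum-tabulate : ∀ {n} (f : A → ℤ) (g : Fin n → A) → listSum f (List.tabulate g) ≡ ∑[ i < n ] f (g i)
  listSum-tabulate {zero}  f g = refl
  listSum-tabulate {suc n} f g = cong (f (g zero) +_) (listSum-tabulate f (g ∘ suc))

  length-concatMap : ∀ {B : Set} (f : A → List B) xs →
                     ⁺ length (concatMap f xs) ≡ listSum (λ x → ⁺ length (f x)) xs
  length-concatMap f []       = refl
  length-concatMap f (x ∷ xs) = trans (cong ⁺_ (List.length-++ (f x)))
    (trans (ℤ.pos-+ (length (f x)) _) (cong (λ u → ⁺ length (f x) + u) (length-concatMap f xs)))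

  ∣listSum∣≤ : ∀ (f : A → ℤ) xs → ∣ listSum f xs ∣ ℕ.≤ sum (List.map (λ x → ∣ f x ∣) xs)
  ∣listSum∣≤ f []       = z≤n
  ∣listSum∣≤ f (x ∷ xs) = ℕ.≤-trans (ℤ.∣i+j∣≤∣i∣+∣j∣ (f x) _) (ℕ.+-monoʳ-≤ ∣ f x ∣ (∣listSum∣≤ f xs))

∑-single : ∀ {n} (f : Fin n → ℤ) i → (∀ j → j ≢ i → f j ≡ 0ℤ) → ∑ f ≡ f i
∑-single {suc n} f i off = trans (sum-remove {i = i} f)
  (trans (cong (f i +_) (∑-zero _ λ j → off (punchIn i j) (Fin.punchInᵢ≢i i j))) (ℤ.+-identityʳ (f i)))

alternating : (ℕ → ℤ) → ℕ → ℤ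
alternating f zero    = f zero
alternating f (suc k) = alternating f k + -1ℤ ℤ.^ suc k * f (suc k)

alternating-cong : ∀ {f g : ℕ → ℤ} → (∀ m → f m ≡ g m) → ∀ k → alternating f k ≡ alternating g k
alternating-cong eq zero    = eq zero
alternating-cong eq (suc k) = cong₂ (λ u v → u + -1ℤ ℤ.^ suc k * v) (alternating-cong eq k) (eq (suc k))

alternating-listSum : ∀ {A : Set} (f : ℕ → A → ℤ) xs k →
  alternating (λ m → listSum (f m) xs) k ≡ listSum (λ x → alternating (λ m → f m x) k) xs
alternating-listSum f []       zero    = refl
alternating-listSum f []       (suc k) =
  trans (cong₂ _+_ (alternating-listSum f [] k) (ℤ.*-zeroʳ (-1ℤ ℤ.^ suc k))) refl
alternating-listSum f (x ∷ xs) k =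
  trans (split k) (cong (alternating (λ m → f m x) k +_) (alternating-listSum f xs k))
  where
  lemma : ∀ a b s u v → a + b + s * (u + v) ≡ (a + s * u) + (b + s * v)
  lemma = solve-∀
  split : ∀ k → alternating (λ m → f m x + listSum (f m) xs) k ≡
                alternating (λ m → f m x) k + alternating (λ m → listSum (f m) xs) k
  split zero    = refl
  split (suc k) = trans (cong (_+ -1ℤ ℤ.^ suc k * (f (suc k) x + listSum (f (suc k)) xs)) (split k))
    (lemma (alternating (λ m → f m x) k) _ (-1ℤ ℤ.^ suc k) (f (suc k) x) _)

-- N m and z m stand for the ranks of the m-chains and of the m-cycles of an exact complex.
alternating-telescope : ∀ (N z : ℕ → ℤ) k → N 0 ≡ z 0 → (∀ m → m ℕ.< k → N (suc m) ≡ z (suc m) + z m) →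
                        alternating N k ≡ -1ℤ ℤ.^ k * z k
alternating-telescope N z zero    base step = trans base (sym (ℤ.*-identityˡ (z 0)))
alternating-telescope N z (suc k) base step =
  trans (cong₂ (λ u v → u + -1ℤ ℤ.^ suc k * v)
               (alternating-telescope N z k base λ m m<k → step m (ℕ.m<n⇒m<1+n m<k)) (step k ℕ.≤-refl))
        (lemma (-1ℤ ℤ.^ k) (z k) (z (suc k)))
  where
  lemma : ∀ s u v → s * u + -1ℤ * s * (v + u) ≡ -1ℤ * s * v
  lemma = solve-∀

∣sign*∣ : ∀ k i → ∣ -1ℤ ℤ.^ k * i ∣ ≡ ∣ i ∣
∣sign*∣ zero    i = cong ∣_∣ (ℤ.*-identityˡ i)
∣sign*∣ (suc k) i = begin
  ∣ -1ℤ * -1ℤ ℤ.^ k * i ∣      ≡⟨ cong ∣_∣ (trans (ℤ.*-assoc -1ℤ (-1ℤ ℤ.^ k) i) (ℤ.-1*i≡-i _)) ⟩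
  ∣ - (-1ℤ ℤ.^ k * i) ∣        ≡⟨ ℤ.∣-i∣≡∣i∣ (-1ℤ ℤ.^ k * i) ⟩
  ∣ -1ℤ ℤ.^ k * i ∣            ≡⟨ ∣sign*∣ k i ⟩
  ∣ i ∣                        ∎
  where open ≡-Reasoning

-- Chains between two elements and the Möbius function

module ChainCount {n} (P : GradedPoset n) where
  open GradedPoset P
  open Inverse enumeration using (to; from; strictlyInverseˡ; strictlyInverseʳ)

  ends : ∀ {m} → Vec Carrier (suc m) → Carrier × Carrier
  ends {m} t = lookup t zero , lookup t (fromℕ m)

  extend : ∀ {m} → Carrier → Carrier → List (Vec Carrier m) → List (Vec Carrier (suc m))
  extend x z ts = if does (x <? z) then List.map (x ∷_) ts else []

  extend-< : ∀ {m x z} → x < z → (ts : List (Vec Carrier m)) → extend x z ts ≡ List.map (x ∷_) ts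
  extend-< {x = x} {z} x<z ts rewrite dec-true (x <? z) x<z = refl

  extend-≮ : ∀ {m x z} → ¬ x < z → (ts : List (Vec Carrier m)) → extend x z ts ≡ []
  extend-≮ {x = x} {z} x≮z ts rewrite dec-false (x <? z) x≮z = refl

  chains : ∀ m → Carrier → Carrier → List (Vec Carrier (suc m))
  chains zero    x y = if does (x ≟ y) then (x ∷ []) ∷ [] else []
  chains (suc m) x y = concatMap (λ z → extend x z (chains m z y)) elements

  ∈-elements : ∀ x → x ∈ elements
  ∈-elements x = subst (_∈ elements) (strictlyInverseʳ x) (∈-tabulate⁺ (to x))

  elements-unique : Unique elements
  elements-unique = Unique.tabulate⁺ λ {i} {j} eq →
    trans (sym (strictlyInverseˡ i)) (trans (cong to eq) (strictlyInverseˡ j))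

  ∈-extend : ∀ {m x z} (ts : List (Vec Carrier m)) {v} → v ∈ extend x z ts →
             x < z × ∃[ t ] t ∈ ts × v ≡ x ∷ t
  ∈-extend {x = x} {z} ts {v} v∈ = by-cases (x <? z)
    where
    by-cases : Dec (x < z) → x < z × ∃[ t ] t ∈ ts × v ≡ x ∷ t
    by-cases (yes x<z) = x<z , ∈-map⁻ (x ∷_) (subst (v ∈_) (extend-< x<z ts) v∈)
    by-cases (no x≮z)  = contradiction (subst (v ∈_) (extend-≮ x≮z ts) v∈) λ ()

  ∈-extend⁺ : ∀ {m x z} {ts : List (Vec Carrier m)} {t} → x < z → t ∈ ts → x ∷ t ∈ extend x z ts
  ∈-extend⁺ {x = x} {z} {ts} {t} x<z t∈ = subst (x ∷ t ∈_) (sym (extend-< x<z ts)) (∈-map⁺ (x ∷_) t∈)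

  chains-sound : ∀ m {x y t} → t ∈ chains m x y → Linked _<_ t × ends t ≡ (x , y)
  chains-sound zero {x} {y} t∈ with x ≟ y
  chains-sound zero {x} {y} (here refl) | yes refl = [-] , refl
  chains-sound (suc m) {x} {y} t∈
    with Any.satisfied (∈-concatMap⁻ (λ z → extend x z (chains m z y)) {xs = elements} t∈)
  ... | z , t∈z with ∈-extend {z = z} (chains m z y) t∈z
  ... | x<z , s@(_ ∷ _) , s∈ , refl with chains-sound m s∈
  ... | l , refl = x<z ∷ l , refl

  chains-complete : ∀ {m} {t : Vec Carrier (suc m)} → Linked _<_ t →
                    t ∈ chains m (proj₁ (ends t)) (proj₂ (ends t))
  chains-complete {t = x ∷ []} [-] with x ≟ x
  ... | yes _  = here refl
  ... | no x≢x = contradiction refl x≢x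
  chains-complete {suc m} {x ∷ y ∷ t} (x<y ∷ l) =
    ∈-concatMap⁺ (λ z → extend x z (chains m z _)) {xs = elements}
      (Any.map (λ { refl → ∈-extend⁺ x<y (chains-complete l) }) (∈-elements y))

  chains-unique : ∀ m x y → Unique (chains m x y)
  chains-unique zero x y with does (x ≟ y)
  ... | true  = [] ∷ []
  ... | false = []
  chains-unique (suc m) x y =
    unique-concatMap (λ z → extend x z (chains m z y)) extend-unique disjoint elements-unique
    where
    extend-unique : ∀ z → Unique (extend x z (chains m z y))
    extend-unique z with does (x <? z)
    ... | true  = Unique.map⁺ Vec.∷-injectiveʳ (chains-unique m z y)
    ... | false = []
    disjoint : ∀ {z w v} → v ∈ extend x z (chains m z y) → v ∈ extend x w (chains m w y) → z ≡ w
    disjoint {z} {w} v∈z v∈w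
      with ∈-extend {z = z} (chains m z y) v∈z | ∈-extend {z = w} (chains m w y) v∈w
    ... | _ , s , s∈ , refl | _ , s′ , s′∈ , eq with Vec.∷-injectiveʳ eq
    ... | refl = trans (sym (cong proj₁ (proj₂ (chains-sound m s∈))))
                       (cong proj₁ (proj₂ (chains-sound m s′∈)))

  chainsOver : List (Carrier × Carrier) → ∀ m → List (Vec Carrier (suc m))
  chainsOver ps m = concatMap (λ (x , y) → chains m x y) ps

  chainsOver-sound : ∀ ps {m t} → t ∈ chainsOver ps m → Linked _<_ t × ends t ∈ ps
  chainsOver-sound ps {m} {t} t∈ = go ps (∈-concatMap⁻ (λ (x , y) → chains m x y) {xs = ps} t∈)
    where
    go : ∀ ps → Any (λ (x , y) → t ∈ chains m x y) ps → Linked _<_ t × ends t ∈ ps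
    go ps t∈ = let l , _ = chains-sound m (proj₂ (Any.satisfied t∈)) in
               l , Any.map (λ t∈ → proj₂ (chains-sound m t∈)) t∈

  chainsOver-complete : ∀ {ps m} {t : Vec Carrier (suc m)} → Linked _<_ t → ends t ∈ ps →
                        t ∈ chainsOver ps m
  chainsOver-complete {ps} {m} l e∈ = ∈-concatMap⁺ (λ (x , y) → chains m x y) {xs = ps}
    (Any.map (λ { refl → chains-complete l }) e∈)

  chainsOver-unique : ∀ {ps} m → Unique ps → Unique (chainsOver ps m)
  chainsOver-unique m = unique-concatMap (λ (x , y) → chains m x y) (λ (x , y) → chains-unique m x y)
    λ v∈ v∈′ → trans (sym (proj₂ (chains-sound m v∈))) (proj₂ (chains-sound m v∈′))

  count : ℕ → Carrier → Carrier → ℤ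
  count m x y = ⁺ length (chains m x y)

  𝟏< : Carrier → Carrier → ℤ
  𝟏< x y = if does (x <? y) then 1ℤ else 0ℤ

  infixr 6.5 Σᴾ
  Σᴾ : (Carrier → ℤ) → ℤ
  Σᴾ f = ∑[ i < size ] f (from i)

  syntax Σᴾ (λ z → u) = Σᴾ[ z ] u

  Σᴾ-cong : ∀ {f g} → (∀ z → f z ≡ g z) → Σᴾ f ≡ Σᴾ g
  Σᴾ-cong eq = sum-cong-≗ (eq ∘ from)

  Σᴾ-single : ∀ f x → (∀ z → z ≢ x → f z ≡ 0ℤ) → Σᴾ f ≡ f x
  Σᴾ-single f x off = trans
    (∑-single (f ∘ from) (to x) λ i i≢x → off (from i) λ { refl → i≢x (sym (strictlyInverseˡ i)) })
    (cong f (strictlyInverseʳ x))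

  count-first : ∀ m x y → count (suc m) x y ≡ Σᴾ[ z ] 𝟏< x z * count m z y
  count-first m x y = begin
    ⁺ length (concatMap (λ z → extend x z (chains m z y)) elements)
      ≡⟨ length-concatMap (λ z → extend x z (chains m z y)) elements ⟩
    listSum (λ z → ⁺ length (extend x z (chains m z y))) elements
      ≡⟨ listSum-tabulate (λ z → ⁺ length (extend x z (chains m z y))) from ⟩
    Σᴾ[ z ] ⁺ length (extend x z (chains m z y))
      ≡⟨ Σᴾ-cong (λ z → length-extend z (chains m z y)) ⟩
    Σᴾ[ z ] 𝟏< x z * count m z y ∎
    where
    open ≡-Reasoning
    length-extend : ∀ z (ts : List (Vec Carrier (suc m))) →
                    ⁺ length (extend x z ts) ≡ 𝟏< x z * ⁺ length ts
    length-extend z ts with does (x <? z)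
    ... | true  = trans (cong ⁺_ (List.length-map (x ∷_) ts)) (sym (ℤ.*-identityˡ _))
    ... | false = sym (ℤ.*-zeroˡ (⁺ length ts))

  count-zero-≡ : ∀ x → count 0 x x ≡ 1ℤ
  count-zero-≡ x rewrite dec-true (x ≟ x) refl = refl

  count-zero-≢ : ∀ {x y} → x ≢ y → count 0 x y ≡ 0ℤ
  count-zero-≢ {x} {y} x≢y rewrite dec-false (x ≟ y) x≢y = refl

  -- Regarded as a matrix, `count m` is the m-th power of `𝟏<`, and powers of a matrix commute with
  -- it. The definition of `chains` splits off the first step, whereas the recursion for μ needs the
  -- last one.
  count-last : ∀ m x y → count (suc m) x y ≡ Σᴾ[ z ] count m x z * 𝟏< z y
  count-last zero x y = begin
    count 1 x y
      ≡⟨ count-first 0 x y ⟩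
    Σᴾ[ z ] 𝟏< x z * count 0 z y
      ≡⟨ Σᴾ-single (λ z → 𝟏< x z * count 0 z y) y (λ z z≢y →
           trans (cong (𝟏< x z *_) (count-zero-≢ z≢y)) (ℤ.*-zeroʳ (𝟏< x z))) ⟩
    𝟏< x y * count 0 y y
      ≡⟨ cong (𝟏< x y *_) (count-zero-≡ y) ⟩
    𝟏< x y * 1ℤ
      ≡⟨ ℤ.*-comm (𝟏< x y) 1ℤ ⟩
    1ℤ * 𝟏< x y
      ≡⟨ cong (_* 𝟏< x y) (count-zero-≡ x) ⟨
    count 0 x x * 𝟏< x y
      ≡⟨ Σᴾ-single (λ z → count 0 x z * 𝟏< z y) x (λ z z≢x →
           trans (cong (_* 𝟏< z y) (count-zero-≢ (z≢x ∘ sym))) (ℤ.*-zeroˡ (𝟏< z y))) ⟨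
    Σᴾ[ z ] count 0 x z * 𝟏< z y ∎
    where open ≡-Reasoning
  count-last (suc m) x y = begin
    count (suc (suc m)) x y
      ≡⟨ count-first (suc m) x y ⟩
    Σᴾ[ w ] 𝟏< x w * count (suc m) w y
      ≡⟨ Σᴾ-cong (λ w → trans (cong (𝟏< x w *_) (count-last m w y))
                              (*-distribˡ-sum (𝟏< x w) λ i → count m w (from i) * 𝟏< (from i) y)) ⟩
    Σᴾ[ w ] Σᴾ[ z ] 𝟏< x w * (count m w z * 𝟏< z y)
      ≡⟨ ∑-comm (λ i j → 𝟏< x (from i) * (count m (from i) (from j) * 𝟏< (from j) y)) ⟩
    Σᴾ[ z ] Σᴾ[ w ] 𝟏< x w * (count m w z * 𝟏< z y)
      ≡⟨ Σᴾ-cong (λ z → trans (Σᴾ-cong λ w → sym (ℤ.*-assoc (𝟏< x w) (count m w z) (𝟏< z y)))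
                              (sym (*-distribʳ-sum (𝟏< z y) λ i → 𝟏< x (from i) * count m (from i) z))) ⟩
    Σᴾ[ z ] (Σᴾ[ w ] 𝟏< x w * count m w z) * 𝟏< z y
      ≡⟨ Σᴾ-cong (λ z → cong (_* 𝟏< z y) (count-first m x z)) ⟨
    Σᴾ[ z ] count (suc m) x z * 𝟏< z y ∎
    where open ≡-Reasoning

  euler : ℕ → Carrier → Carrier → ℤ
  euler k x y = alternating (λ m → count m x y) k

  -- With η for the matrix `𝟏<`, `euler k` is the partial geometric series S k = Σ (-η)ᵐ over m ≤ k,
  -- and the identity is S (k + 1) = 1 - S k η.
  euler-suc : ∀ k x y → euler (suc k) x y ≡ count 0 x y - (Σᴾ[ z ] euler k x z * 𝟏< z y)
  euler-suc zero x y = cong (λ u → count 0 x y + u)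
    (trans (ℤ.-1*i≡-i (count 1 x y)) (cong -_ (count-last 0 x y)))
  euler-suc (suc k) x y = begin
    euler (suc k) x y + s * count (suc (suc k)) x y
      ≡⟨ cong₂ (λ u v → u + s * v) (euler-suc k x y) (count-last (suc k) x y) ⟩
    count 0 x y - (Σᴾ[ z ] euler k x z * 𝟏< z y) + s * (Σᴾ[ z ] count (suc k) x z * 𝟏< z y)
      ≡⟨ lemma₁ (count 0 x y) (Σᴾ[ z ] euler k x z * 𝟏< z y) (-1ℤ ℤ.^ suc k)
                (Σᴾ[ z ] count (suc k) x z * 𝟏< z y) ⟩
    count 0 x y - ((Σᴾ[ z ] euler k x z * 𝟏< z y) + -1ℤ ℤ.^ suc k * (Σᴾ[ z ] count (suc k) x z * 𝟏< z y))
      ≡⟨ cong (λ u → count 0 x y - ((Σᴾ[ z ] euler k x z * 𝟏< z y) + u))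
           (*-distribˡ-sum (-1ℤ ℤ.^ suc k) λ i → count (suc k) x (from i) * 𝟏< (from i) y) ⟩
    count 0 x y - ((Σᴾ[ z ] euler k x z * 𝟏< z y) + (Σᴾ[ z ] -1ℤ ℤ.^ suc k * (count (suc k) x z * 𝟏< z y)))
      ≡⟨ cong (λ u → count 0 x y - u) 
           (∑-distrib-+ (λ i → euler k x (from i) * 𝟏< (from i) y)
                        λ i → -1ℤ ℤ.^ suc k * (count (suc k) x (from i) * 𝟏< (from i) y)) ⟨
    count 0 x y - (Σᴾ[ z ] (euler k x z * 𝟏< z y + -1ℤ ℤ.^ suc k * (count (suc k) x z * 𝟏< z y)))
      ≡⟨ cong (λ u → count 0 x y - u) (Σᴾ-cong λ z →
           lemma₂ (euler k x z) (𝟏< z y) (-1ℤ ℤ.^ suc k) (count (suc k) x z)) ⟩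
    count 0 x y - (Σᴾ[ z ] euler (suc k) x z * 𝟏< z y) ∎
    where
    open ≡-Reasoning
    s = -1ℤ ℤ.^ suc (suc k)
    lemma₁ : ∀ a b s c → a - b + -1ℤ * s * c ≡ a - (b + s * c)
    lemma₁ = solve-∀
    lemma₂ : ∀ a b s c → a * b + s * (c * b) ≡ (a + s * c) * b
    lemma₂ = solve-∀

  module _ {μ : Carrier → Carrier → ℤ} (isMöbius : IsMöbiusFunction finitePoset μ) where
    open IsMöbiusFunction isMöbius
    open ≡-Reasoning

    private
      𝟏<-≮ : ∀ {z y} → ¬ z < y → 𝟏< z y ≡ 0ℤ
      𝟏<-≮ {z} {y} z≮y rewrite dec-false (z <? y) z≮y = refl

      below : Carrier → Carrier → ℤ
      below x y = Σᴾ[ z ] μ x z * 𝟏< z y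

      below-zero : ∀ {x y} → ¬ x < y → below x y ≡ 0ℤ
      below-zero {x} {y} x≮y = ∑-zero _ λ i → term (from i)
        where
        term : ∀ z → μ x z * 𝟏< z y ≡ 0ℤ
        term z with x ≤? z
        ... | no x≰z = trans (cong (_* 𝟏< z y) (μ-≰ x≰z)) (ℤ.*-zeroˡ (𝟏< z y))
        ... | yes x≤z = trans (cong (μ x z *_) (𝟏<-≮ λ z<y → x≮y (≤-<-trans x≤z z<y)))
                              (ℤ.*-zeroʳ (μ x z))
          where
          ≤-<-trans : ∀ {a b c} → a ≤ b → b < c → a < c
          ≤-<-trans {a} {b} a≤b b<c with a ≟ b
          ... | yes refl = b<c
          ... | no a≢b   = <-trans (a≤b , a≢b) b<c

      μ-below : ∀ {x y} → x < y → μ x y ≡ - below x y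
      μ-below {x} {y} x<y = trans (μ-< x<y) (cong -_ (begin
        listSum (μ x) (filter (λ z → (x ≤? z) ×-dec (z <? y)) elements)
          ≡⟨ listSum-filter (λ z → (x ≤? z) ×-dec (z <? y)) (μ x) elements ⟩
        listSum (λ z → if does ((x ≤? z) ×-dec (z <? y)) then μ x z else 0ℤ) elements
          ≡⟨ listSum-tabulate _ from ⟩
        Σᴾ[ z ] (if does ((x ≤? z) ×-dec (z <? y)) then μ x z else 0ℤ)
          ≡⟨ Σᴾ-cong term ⟩
        below x y ∎))
        where
        term : ∀ z → (if does ((x ≤? z) ×-dec (z <? y)) then μ x z else 0ℤ) ≡ μ x z * 𝟏< z y
        term z with x ≤? z
        ... | no x≰z rewrite μ-≰ x≰z = sym (ℤ.*-zeroˡ (𝟏< z y))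
        ... | yes x≤z with does (z <? y)
        ... | true  = sym (ℤ.*-identityʳ (μ x z))
        ... | false = sym (ℤ.*-zeroʳ (μ x z))

      -- In matrix form μ = 1 - μ η with η the matrix `𝟏<`; that is, μ is inverse to the zeta matrix
      -- 1 + η. The three defining cases merge because `below x y` vanishes unless x < y.
      μ-recursion : ∀ x y → μ x y ≡ count 0 x y - below x y
      μ-recursion x y = by-cases (x ≟ y) (x ≤? y)
        where
        by-cases : Dec (x ≡ y) → Dec (x ≤ y) → μ x y ≡ count 0 x y - below x y
        by-cases (yes refl) _ =
          trans (μ-refl x) (sym (cong₂ _-_ (count-zero-≡ x) (below-zero λ (_ , x≢x) → x≢x refl)))
        by-cases (no x≢y) (yes x≤y) = trans (μ-below (x≤y , x≢y))
          (sym (trans (cong (_- below x y) (count-zero-≢ x≢y)) (ℤ.+-identityˡ (- below x y))))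
        by-cases (no x≢y) (no x≰y) =
          trans (μ-≰ x≰y) (sym (cong₂ _-_ (count-zero-≢ x≢y) (below-zero λ (x≤y , _) → x≰y x≤y)))

    -- P. Hall's theorem; k bounds the length of the interval from above.
    μ≡euler : ∀ k x y → r y ℕ.≤ k ℕ.+ r x → μ x y ≡ euler k x y
    μ≡euler zero x y ry≤rx = trans (μ-recursion x y)
      (trans (cong (λ u → count 0 x y - u) (below-zero λ x<y → ℕ.<⇒≱ (r-mono-< x<y) ry≤rx))
             (ℤ.+-identityʳ _))
    μ≡euler (suc k) x y ry≤ = begin
      μ x y
        ≡⟨ μ-recursion x y ⟩
      count 0 x y - below x y
        ≡⟨ cong (λ u → count 0 x y - u) (Σᴾ-cong term) ⟩
      count 0 x y - (Σᴾ[ z ] euler k x z * 𝟏< z y)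
        ≡⟨ euler-suc k x y ⟨
      euler (suc k) x y ∎
      where
      term : ∀ z → μ x z * 𝟏< z y ≡ euler k x z * 𝟏< z y
      term z = by-cases (z <? y)
        where
        by-cases : Dec (z < y) → μ x z * 𝟏< z y ≡ euler k x z * 𝟏< z y
        -- Ranks increase strictly, so the bound on the rank of y with k + 1 yields the one for z
        -- with k.
        by-cases (yes z<y) = cong (_* 𝟏< z y) (μ≡euler k x z (ℕ.s≤s⁻¹ (ℕ.<-≤-trans (r-mono-< z<y) ry≤)))
        by-cases (no z≮y) rewrite 𝟏<-≮ z≮y = trans (ℤ.*-zeroʳ (μ x z)) (sym (ℤ.*-zeroʳ (euler k x z)))

  pairs-unique : ∀ {Q : Pred (Carrier × Carrier) 0ℓ} (Q? : Decidable Q) →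
                 Unique (filter Q? (cartesianProduct elements elements))
  pairs-unique Q? = Unique.filter⁺ Q? (Unique.cartesianProduct⁺ elements-unique elements-unique)

  ∈-pairs : ∀ {Q : Pred (Carrier × Carrier) 0ℓ} (Q? : Decidable Q) {p} → Q p →
            p ∈ filter Q? (cartesianProduct elements elements)
  ∈-pairs Q? {x , y} q = ∈-filter⁺ Q? (∈-cartesianProduct⁺ (∈-elements x) (∈-elements y)) q

  module _ {μ : Carrier → Carrier → ℤ} (isMöbius : IsMöbiusFunction finitePoset μ) (k : ℕ) where
    open ≡-Reasoning

    -- P. Hall's theorem summed over the pairs. A pair of span k satisfies r y ≤ k + r x, so the
    -- alternating sum may stop at k.
    alternating-chains : alternating (λ m → ⁺ length (chainsOver (pairsOfSpan k) m)) k ≡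
                         listSum (λ (x , y) → μ x y) (pairsOfSpan k)
    alternating-chains = begin
      alternating (λ m → ⁺ length (chainsOver (pairsOfSpan k) m)) k
        ≡⟨ alternating-cong (λ m → length-concatMap (λ (x , y) → chains m x y) (pairsOfSpan k)) k ⟩
      alternating (λ m → listSum (λ (x , y) → count m x y) (pairsOfSpan k)) k
        ≡⟨ alternating-listSum (λ m (x , y) → count m x y) (pairsOfSpan k) k ⟩
      listSum (λ (x , y) → euler k x y) (pairsOfSpan k)
        ≡⟨ listSum-cong (pairsOfSpan k) (λ {(x , y)} p∈ → sym (μ≡euler isMöbius k x y (bound p∈))) ⟩
      listSum (λ (x , y) → μ x y) (pairsOfSpan k) ∎
      where
      bound : ∀ {x y} → (x , y) ∈ pairsOfSpan k → r y ℕ.≤ k ℕ.+ r x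
      bound {x} {y} p∈
        with ∈-filter⁻ (λ (x , y) → (x ≤? y) ×-dec (r y ℕ.∸ r x ℕ.≟ k))
                       {xs = cartesianProduct elements elements} p∈
      ... | _ , _ , refl = subst (r y ℕ.≤_) (ℕ.+-comm (r x) _) (ℕ.m≤n+m∸n (r y) (r x))

-- Ranks of cycle groups

module Coordinates {B : Set} (_≟_ : DecidableEquality B) {N : ℕ} (finite : B ↔ Fin N) where
  open Coefficients _≟_
  open Inverse finite using (to; strictlyInverseˡ; strictlyInverseʳ) renaming (from to enum) public
  open ≡-Reasoning

  coords : FormalSum B → Fin N → ℤ
  coords c i = coef c (enum i)

  fromCoords : (Fin N → ℤ) → FormalSum B
  fromCoords w = List.tabulate λ i → w i , enum i

  enum-≢ : ∀ {b i} → i ≢ to b → enum i ≢ b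
  enum-≢ {i = i} i≢ refl = i≢ (sym (strictlyInverseˡ i))

  coef-from-coords : ∀ {c c′} → (∀ i → coords c i ≡ coords c′ i) → c ≈ c′
  coef-from-coords {c} {c′} eq b = subst (λ b → coef c b ≡ coef c′ b) (strictlyInverseʳ b) (eq (to b))

  ext-coords : ∀ (f : B → ℤ) c → ext f c ≡ ∑[ i < N ] coords c i * f (enum i)
  ext-coords f []            = sym (∑-zero {N} _ λ i → ℤ.*-zeroˡ (f (enum i)))
  ext-coords f ((a , b) ∷ c) = sym (begin
    ∑[ i < N ] (entry i + coords c i) * f (enum i)
      ≡⟨ sum-cong-≗ (λ i → ℤ.*-distribʳ-+ (f (enum i)) (entry i) (coords c i)) ⟩
    ∑[ i < N ] (entry i * f (enum i) + coords c i * f (enum i))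
      ≡⟨ ∑-distrib-+ (λ i → entry i * f (enum i)) _ ⟩
    ∑[ i < N ] entry i * f (enum i) + ∑[ i < N ] coords c i * f (enum i)
      ≡⟨ cong₂ _+_ (∑-single (λ i → entry i * f (enum i)) (to b) (λ i i≢ →
           trans (cong (_* f (enum i)) (entry-off i i≢)) (ℤ.*-zeroˡ (f (enum i)))))
           (sym (ext-coords f c)) ⟩
    entry (to b) * f (enum (to b)) + ext f c
      ≡⟨ cong (_+ ext f c) (cong₂ _*_ entry-on (cong f (strictlyInverseʳ b))) ⟩
    a * f b + ext f c ∎)
    where
    entry : Fin N → ℤ
    entry i = if does (b ≟ enum i) then a else 0ℤ
    entry-on : entry (to b) ≡ a
    entry-on rewrite dec-true (b ≟ enum (to b)) (sym (strictlyInverseʳ b)) = refl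
    entry-off : ∀ i → i ≢ to b → entry i ≡ 0ℤ
    entry-off i i≢ rewrite dec-false (b ≟ enum i) (enum-≢ i≢ ∘ sym) = refl

  coords-fromCoords : ∀ w i → coords (fromCoords w) i ≡ w i
  coords-fromCoords w i = begin
    coef (fromCoords w) (enum i)
      ≡⟨ coef-ext _≟_ (fromCoords w) (enum i) ⟩
    ext (ind _≟_ (enum i)) (fromCoords w)
      ≡⟨ ext-tabulate w enum ⟩
    ∑[ j < N ] w j * ind _≟_ (enum i) (enum j)
      ≡⟨ ∑-single (λ j → w j * ind _≟_ (enum i) (enum j)) i (λ j j≢i →
           trans (cong (w j *_) (ind-≢ _≟_ {enum i} {enum j} (enum-≢ (j≢i ∘ λ { refl → strictlyInverseˡ i }))))
                 (ℤ.*-zeroʳ (w j))) ⟩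
    w i * ind _≟_ (enum i) (enum i)
      ≡⟨ trans (cong (w i *_) (ind-refl _≟_ (enum i))) (ℤ.*-identityʳ (w i)) ⟩
    w i ∎
    where
    ext-tabulate : ∀ {f : B → ℤ} {l} (u : Fin l → ℤ) (g : Fin l → B) →
                   ext f (List.tabulate λ i → u i , g i) ≡ ∑[ i < l ] u i * f (g i)
    ext-tabulate {l = zero}  u g = refl
    ext-tabulate {f} {suc l} u g = cong (u zero * f (g zero) +_) (ext-tabulate {f} (u ∘ suc) (g ∘ suc))

module BoundaryMatrix (C : FreeComplex) {m N N′} (finite : FreeComplex.Gen C (suc m) ↔ Fin N)
                      (finite′ : FreeComplex.Gen C m ↔ Fin N′) where
  open FreeComplex C
  module Source = Coordinates _≟_ finite
  module Target = Coordinates _≟_ finite′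

  matrix : Fin N′ → Fin N → ℤ
  matrix j i = coef (∂gen (Source.enum i)) (Target.enum j)

  matrix-coords : ∀ c j → (matrix ∙ Source.coords c) j ≡ Target.coords (∂ c) j
  matrix-coords c j = sym (begin
    coef (∂ c) (Target.enum j)
      ≡⟨ coef-ext _≟_ (∂ c) (Target.enum j) ⟩
    ext (ind _≟_ (Target.enum j)) (linear ∂gen c)
      ≡⟨ trans (ext-linear (ind _≟_ (Target.enum j)) ∂gen c)
           (ext-cong (λ b → sym (coef-ext _≟_ (∂gen b) (Target.enum j))) c) ⟩
    ext (λ b → coef (∂gen b) (Target.enum j)) c
      ≡⟨ Source.ext-coords (λ b → coef (∂gen b) (Target.enum j)) c ⟩
    ∑[ i < N ] Source.coords c i * matrix j i
      ≡⟨ sum-cong-≗ (λ i → ℤ.*-comm (Source.coords c i) (matrix j i)) ⟩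
    (matrix ∙ Source.coords c) j ∎)
    where open ≡-Reasoning

  cycle⇒ker : ∀ c → IsCycle c → Ker matrix (Source.coords c)
  cycle⇒ker c z j = trans (matrix-coords c j) (z (Target.enum j))

  ∂-fromCoords : ∀ w j → Target.coords (∂ (Source.fromCoords w)) j ≡ (matrix ∙ w) j
  ∂-fromCoords w j = trans (sym (matrix-coords (Source.fromCoords w) j))
    (sum-cong-≗ λ i → cong (matrix j i *_) (Source.coords-fromCoords w i))

  ker⇒cycle : ∀ w → Ker matrix w → IsCycle (Source.fromCoords w)
  ker⇒cycle w z =
    Target.coef-from-coords {∂ (Source.fromCoords w)} {[]} λ j → trans (∂-fromCoords w j) (z j)

module CycleSpace (C : FreeComplex) {N : ℕ → ℕ} (finite : ∀ m → FreeComplex.Gen C m ↔ Fin (N m)) where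
  open FreeComplex C
  module B m = BoundaryMatrix C (finite (suc m)) (finite m)
  module X m = Coordinates (_≟_ {m}) (finite m)

  Z : ∀ m → (Fin (N m) → ℤ) → Set
  Z zero    w = ⊤
  Z (suc m) w = Ker (B.matrix m) w

  Z-basis : ∀ m → ∃[ z ] RationalBasis (Z m) z
  -- Every chain of degree 0 is a cycle, and the kernel of a matrix without rows is the whole space.
  Z-basis zero    = let z , _ , basis = ker-basis {0} {N 0} (λ ()) in
                    z , basis-resp (λ _ → tt) (λ _ ()) basis
  Z-basis (suc m) = let z , _ , basis = ker-basis (B.matrix m) in z , basis

  cycle⇒Z : ∀ m c → IsCycle c → Z m (X.coords m c)
  cycle⇒Z zero    c p = tt
  cycle⇒Z (suc m) c p = B.cycle⇒ker m c p

  Z⇒cycle : ∀ m w → Z m w → IsCycle (X.fromCoords m w)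
  Z⇒cycle zero    w p = tt
  Z⇒cycle (suc m) w p = B.ker⇒cycle m w p

  z : ℕ → ℕ
  z m = proj₁ (Z-basis m)

  z-zero : N 0 ≡ z 0
  z-zero = ℕ.≤-antisym (proj₁ (proj₂ (ker-basis {0} {N 0} (λ ()))))
    (independent⇒≤ (RationalBasis.vec basis) (RationalBasis.independent basis))
    where basis = proj₂ (Z-basis 0)

  module _ (∂-∂ : ∀ {m} (c : FormalSum (Gen (suc (suc m)))) → ∂ (∂ c) ≈ []) where
    open ≡-Reasoning

    image⊆Z : ∀ m w → Z m (B.matrix m ∙ w)
    image⊆Z zero    w   = tt
    image⊆Z (suc m) w j = begin
      (B.matrix m ∙ (B.matrix (suc m) ∙ w)) j
        ≡⟨ sum-cong-≗ (λ i → cong (B.matrix m j i *_) (B.∂-fromCoords (suc m) w i)) ⟨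
      (B.matrix m ∙ X.coords (suc m) (∂ (X.fromCoords (suc (suc m)) w))) j
        ≡⟨ B.cycle⇒ker m (∂ (X.fromCoords (suc (suc m)) w)) (∂-∂ (X.fromCoords (suc (suc m)) w)) j ⟩
      0ℤ ∎

    Z⊆image : ∀ m → Trivial (H m) → ∀ {y} → Z m y → ∃[ w ] ∀ j → (B.matrix m ∙ w) j ≡ y j
    Z⊆image m trivial {y} y∈ with trivial (cycle (X.fromCoords m y) (Z⇒cycle m y y∈))
    ... | b , eq = X.coords (suc m) b , λ j → begin
      (B.matrix m ∙ X.coords (suc m) b) j
        ≡⟨ B.matrix-coords m b j ⟩
      X.coords m (∂ b) j
        ≡⟨ eq (X.enum m j) ⟩
      X.coords m (X.fromCoords m y ++ []) j
        ≡⟨ cong (λ c → X.coords m c j) (List.++-identityʳ (X.fromCoords m y)) ⟩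
      X.coords m (X.fromCoords m y) j
        ≡⟨ X.coords-fromCoords m y j ⟩
      y j ∎

    -- Triviality of `H m` makes the image of the boundary equal to `Z m`, so the boundary has rank
    -- z m and nullity z (m + 1).
    z-suc : ∀ m → Trivial (H m) → N (suc m) ≡ z (suc m) ℕ.+ z m
    z-suc m trivial = sym (rank-nullity (B.matrix m) (proj₂ (Z-basis (suc m))) (proj₂ (Z-basis m))
      (image⊆Z m) (Z⊆image m trivial))

    -- Each N (m + 1) splits into z (m + 1) + z m, so the alternating sum telescopes. Only the
    -- cycles of degree k survive, where no exactness is assumed.
    euler-rank : ∀ k → (∀ m → m ℕ.< k → Trivial (H m)) → ∣ alternating (λ m → ⁺ N m) k ∣ ≡ z k
    euler-rank k trivial = trans
      (cong ∣_∣ (alternating-telescope (λ m → ⁺ N m) (λ m → ⁺ z m) k (cong ⁺_ z-zero) λ m m<k →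
        trans (cong ⁺_ (z-suc m (trivial m m<k))) (ℤ.pos-+ (z (suc m)) (z m))))
      (∣sign*∣ k (⁺ z k))

-- `κ` assigns coordinates that are additive and detect zero, so A embeds modulo `_≈_` into the
-- functions B → ℤ, and independence can be tested on integer vectors. For cycles without boundaries
-- the coefficients are such coordinates.
module EmbeddedGroup (A : AbelianGroup 0ℓ 0ℓ) {B : Set} (κ : AbelianGroup.Carrier A → B → ℤ)
  (κ-∙ : ∀ x y b → κ (AbelianGroup._∙_ A x y) b ≡ κ x b + κ y b)
  (κ-ε : ∀ b → κ (AbelianGroup.ε A) b ≡ 0ℤ)
  (κ-⁻¹ : ∀ x b → κ (AbelianGroup._⁻¹ A x) b ≡ - κ x b)
  (≈ε⇒κ≡0 : ∀ {x} → AbelianGroup._≈_ A x (AbelianGroup.ε A) → ∀ b → κ x b ≡ 0ℤ)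
  (κ≡0⇒≈ε : ∀ {x} → (∀ b → κ x b ≡ 0ℤ) → AbelianGroup._≈_ A x (AbelianGroup.ε A)) where
  private
    open AbelianGroup A using (Carrier; monoid; commutativeMonoid)
    open MonoidMult monoid using () renaming (_×_ to _×ᴬ_)
    open MonoidSum commutativeMonoid using () renaming (sum to ∑ᴬ)
    open ≡-Reasoning

    combination : ∀ {s} → (Fin s → ℤ) → (Fin s → Carrier) → Carrier
    combination a v = ∑ᴬ λ i → _·_ A (a i) (v i)

    κ-× : ∀ n x b → κ (n ×ᴬ x) b ≡ ⁺ n * κ x b
    κ-× zero    x b = trans (κ-ε b) (sym (ℤ.*-zeroˡ (κ x b)))
    κ-× (suc n) x b = trans (κ-∙ x (n ×ᴬ x) b)
      (trans (cong (κ x b +_) (κ-× n x b)) (lemma (⁺ n) (κ x b)))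
      where
      lemma : ∀ n u → u + n * u ≡ (1ℤ + n) * u
      lemma = solve-∀

    κ-· : ∀ a x b → κ (_·_ A a x) b ≡ a * κ x b
    κ-· (⁺ n)    x b = κ-× n x b
    κ-· -[1+ n ] x b = trans (κ-⁻¹ (suc n ×ᴬ x) b)
      (trans (cong -_ (κ-× (suc n) x b)) (ℤ.neg-distribˡ-* (⁺ suc n) (κ x b)))

    κ-sum : ∀ {s} (a : Fin s → ℤ) (v : Fin s → Carrier) b →
            κ (combination a v) b ≡ ∑[ i < s ] a i * κ (v i) b
    κ-sum {zero}  a v b = κ-ε b
    κ-sum {suc s} a v b = trans (κ-∙ (_·_ A (a zero) (v zero)) (combination (a ∘ suc) (v ∘ suc)) b)
      (cong₂ _+_ (κ-· (a zero) (v zero) b) (κ-sum (a ∘ suc) (v ∘ suc) b))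

  independent-κ : ∀ {s} {u : Fin s → Carrier} → LinearlyIndependent A u → (a : Fin s → ℤ) →
                  (∀ b → ∑[ i < s ] a i * κ (u i) b ≡ 0ℤ) → ∀ i → a i ≡ 0ℤ
  independent-κ {u = u} u-ind a rel = u-ind a (κ≡0⇒≈ε λ b → trans (κ-sum a u b) (rel b))

  -- The basis vectors, realized in A, form an independent family of ρ elements. Conversely, an
  -- independent family in A has independent coordinate vectors in K, which the basis spans
  -- rationally, so `steinitz` bounds its size.
  hasRank : ∀ {N ρ} (finite : B ↔ Fin N) {K : (Fin N → ℤ) → Set} → RationalBasis K ρ →
            (∀ x → K (κ x ∘ Inverse.from finite)) →
            (∀ w → K w → ∃[ x ] ∀ i → κ x (Inverse.from finite i) ≡ w i) → HasRank A ρ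
  hasRank {N} {ρ} finite basis κ∈K realize = (v , v-independent) , λ u u-ind →
    steinitz (λ i → κ (u i) ∘ from) vec
      (λ a rel → independent-κ u-ind a λ b →
        subst (λ b → ∑[ i < _ ] a i * κ (u i) b ≡ 0ℤ) (strictlyInverseʳ b) (rel (to b)))
      (λ i → spans _ (κ∈K (u i)))
    where
    open Inverse finite using (to; from; strictlyInverseʳ)
    open RationalBasis basis
    v : Fin ρ → Carrier
    v i = proj₁ (realize (vec i) (vec∈ i))
    κ-v : ∀ i j → κ (v i) (from j) ≡ vec i j
    κ-v i = proj₂ (realize (vec i) (vec∈ i))
    v-independent : LinearlyIndependent A v
    v-independent a rel = independent a λ j → begin
      ∑[ i < ρ ] a i * vec i j           ≡⟨ sum-cong-≗ (λ i → cong (a i *_) (κ-v i j)) ⟨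
      ∑[ i < ρ ] a i * κ (v i) (from j)  ≡⟨ κ-sum a v (from j) ⟨
      κ (combination a v) (from j)       ≡⟨ ≈ε⇒κ≡0 rel (from j) ⟩
      0ℤ                                 ∎

-- φ preserves independence, since every coordinate of x is a coordinate of φ x.
module _ (C D : FreeComplex) {N N′ : ℕ → ℕ}
  (finite : ∀ m → FreeComplex.Gen C m ↔ Fin (N m)) (finite′ : ∀ m → FreeComplex.Gen D m ↔ Fin (N′ m))
  {m} (φ : FreeComplex.Cycle C m → FreeComplex.Cycle D m) (ι : FreeComplex.Gen C m → FreeComplex.Gen D m)
  (coef-φ : ∀ x b → FreeComplex.coef C (FreeComplex.Cycle.chain x) b ≡
                      FreeComplex.coef D (FreeComplex.Cycle.chain (φ x)) (ι b)) where
  private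
    module C = FreeComplex C
    module D = FreeComplex D
    module Cᶻ = CycleSpace C finite
    module Dᶻ = CycleSpace D finite′
    module Cᴮ = RationalBasis (proj₂ (Cᶻ.Z-basis m))
    module Dᴮ = RationalBasis (proj₂ (Dᶻ.Z-basis m))
    open ≡-Reasoning

    v : Fin (Cᶻ.z m) → C.Cycle m
    v i = C.cycle (Cᶻ.X.fromCoords m (Cᴮ.vec i)) (Cᶻ.Z⇒cycle m (Cᴮ.vec i) (Cᴮ.vec∈ i))

    u : Fin (Cᶻ.z m) → Fin (N′ m) → ℤ
    u i = Dᶻ.X.coords m (D.chain (φ (v i)))

    index : Fin (N m) → Fin (N′ m)
    index j = Inverse.to (finite′ m) (ι (Cᶻ.X.enum m j))

    vec≡u : ∀ i j → Cᴮ.vec i j ≡ u i (index j)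
    vec≡u i j = begin
      Cᴮ.vec i j                                      ≡⟨ Cᶻ.X.coords-fromCoords m (Cᴮ.vec i) j ⟨
      C.coef (C.chain (v i)) (Cᶻ.X.enum m j)          ≡⟨ coef-φ (v i) (Cᶻ.X.enum m j) ⟩
      D.coef (D.chain (φ (v i))) (ι (Cᶻ.X.enum m j))
        ≡⟨ cong (D.coef (D.chain (φ (v i)))) (Inverse.strictlyInverseʳ (finite′ m) (ι (Cᶻ.X.enum m j))) ⟨
      u i (index j)                                   ∎

  z-mono : Cᶻ.z m ℕ.≤ Dᶻ.z m
  z-mono = steinitz u Dᴮ.vec
    (λ a rel → Cᴮ.independent a λ j → trans (sum-cong-≗ λ i → cong (a i *_) (vec≡u i j)) (rel (index j)))
    (λ i → Dᴮ.spans (u i) (Dᶻ.cycle⇒Z m (D.chain (φ (v i))) (D.isCycle (φ (v i)))))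

-- The homology of `Δ⟨ k ⟩` in degree k

module _ {n} (P : GradedPoset n) (k : ℕ) where
  open GradedPoset P hiding (H)
  open Ambient _≟_
  open RankFiltration P
  open ChainCount P
  private
    module M = MagnitudeChains P k
    module Dₖ = SimplicialHomology _≟_ Δ⟨ k ⟩ (λ t → linked? t ×-dec (rankSpan t ℕ.≤? k))

    ends-ordered : ∀ {m} {t : Vec Carrier (suc m)} → Linked _<_ t → proj₁ (ends t) ≤ proj₂ (ends t)
    ends-ordered {t = x ∷ []}    [-]       = ≤-refl
    ends-ordered {t = x ∷ y ∷ t} (x<y ∷ l) = ≤-trans (proj₁ x<y) (ends-ordered l)

    -- Chains are listed by their pairs of ends, since the span depends only on these. For `_≡ k`
    -- the list `pairs` is `pairsOfSpan k` by definition, so the numbers of magnitude generators are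
    -- those counted through the Möbius function.
    module Spans (Q : ℕ → Set) (Q? : ∀ s → Dec (Q s)) where

      pair? : ∀ (p : Carrier × Carrier) → Dec (proj₁ p ≤ proj₂ p × Q (r (proj₂ p) ℕ.∸ r (proj₁ p)))
      pair? (x , y) = (x ≤? y) ×-dec Q? (r y ℕ.∸ r x)

      pairs : List (Carrier × Carrier)
      pairs = filter pair? (cartesianProduct elements elements)

      listed⇒span : ∀ {m} {t : Vec Carrier (suc m)} → t ∈ chainsOver pairs m →
                    Linked _<_ t × Q (rankSpan t)
      listed⇒span t∈ with chainsOver-sound pairs t∈
      ... | l , e∈ = l , proj₂ (proj₂ (∈-filter⁻ pair? {xs = cartesianProduct elements elements} e∈))

      span⇒listed : ∀ {m} {t : Vec Carrier (suc m)} → Linked _<_ t → Q (rankSpan t) →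
                    t ∈ chainsOver pairs m
      span⇒listed l q = chainsOver-complete l (∈-pairs pair? (ends-ordered l , q))

      finite : ∀ {m} {R : Vec Carrier (suc m) → Set} → (∀ {t} → Linked _<_ t × Q (rankSpan t) → R t) →
               (∀ {t} → R t → Linked _<_ t × Q (rankSpan t)) →
               Refinement (Vec Carrier (suc m)) R ↔ Fin (length (chainsOver pairs m))
      finite {m} f g = refinement↔Fin _≟ⱽ_ (chainsOver-unique m (pairs-unique pair?)) (f ∘ listed⇒span)
        λ q → let l , s = g q in span⇒listed l s

    module Exactly = Spans (_≡ k) (ℕ._≟ k)
    module AtMost  = Spans (ℕ._≤ k) (ℕ._≤? k)

    finiteᴹ : ∀ m → M.Gen m ↔ Fin (length (chainsOver (pairsOfSpan k) m))
    finiteᴹ m = Exactly.finite (λ (l , s) → span⇒generator l s) generator⇒span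

    finiteₖ : ∀ m → Dₖ.Gen m ↔ Fin (length (chainsOver AtMost.pairs m))
    finiteₖ m = AtMost.finite (λ q → q) (λ q → q)

    -- A cycle of `Δ⟨ k ⟩` has zero ambient boundary, hence zero boundary in the quotient `MC k`.
    top : Dₖ.Cycle k → M.Cycle k
    top x = M.cycle (M.restrict (Dₖ.include (Dₖ.chain x)))
      (TopPart.restrict-cycle k (Dₖ.include (Dₖ.chain x)) supp
        (boundaryless (Dₖ.include (Dₖ.chain x)) (Dₖ.include-cycle x)))
      where
      supp : Supp (suc k) (Dₖ.include (Dₖ.chain x))
      supp t ¬w = Dₖ.include-supported (Dₖ.chain x) t λ (l , s) → ¬w (l , s≤s s)
      boundaryless : ∀ {m} (c : FormalSum (Vec Carrier (suc m))) → Dₖ.AmbientCycle c → BoundaryWithin k c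
      boundaryless {zero}  c p      = tt
      boundaryless {suc m} c p t ¬w = p t

    promote : Dₖ.Gen k → M.Gen k
    promote b = M.element (value b)
      -- A chain of k steps has span at least k.
      (let l , s = Dₖ.Q! b in span⇒generator l (ℕ.≤-antisym s (length≤rankSpan l)))

    coef-top : ∀ x b → Dₖ.coefᴳ (Dₖ.chain x) b ≡ M.coefᴳ (M.chain (top x)) (promote b)
    coef-top x b = trans (sym (Dₖ.coef-include (Dₖ.chain x) b))
      (sym (M.coef-restrict (Dₖ.include (Dₖ.chain x)) (promote b)))

    module ZM = CycleSpace (MC k) finiteᴹ

    module Zₖ = CycleSpace Dₖ.C finiteₖ

    no-boundaries : ¬ Dₖ.Gen (suc k)
    no-boundaries b = let l , s = Dₖ.Q! b in ℕ.<⇒≱ (length≤rankSpan l) s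

    -- A bounding chain would consist of generators with k + 1 steps and span at most k. There are
    -- none, so its list is empty, and homology in degree k is the group of cycles.
    ∼0⇒≈[] : ∀ {z : Dₖ.Cycle k} → z Dₖ.∼ Dₖ.0ᶻ → Dₖ.chain z Dₖ.≈ᴳ []
    ∼0⇒≈[] {z} ([]          , eq) b =
      sym (trans (eq b) (cong (λ c → Dₖ.coefᴳ c b) (List.++-identityʳ (Dₖ.chain z))))
    ∼0⇒≈[] {z} ((_ , g) ∷ _ , eq)   = contradiction g no-boundaries

    -- In degree k the chains of span at most k have span exactly k.
    zₖ≤zᴹ : Zₖ.z k ℕ.≤ ZM.z k
    zₖ≤zᴹ = z-mono Dₖ.C (MC k) finiteₖ finiteᴹ top promote coef-top

  topRank : ℕ
  topRank = Zₖ.z k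

  -- HasRank only sees the operations of the group. Keeping the proof of the group laws
  -- variable spares the type checker from comparing such proofs.
  Hₖ : IsAbelianGroup (Dₖ._∼_ {k}) Dₖ._+ᶻ_ Dₖ.0ᶻ Dₖ.-ᶻ_ → AbelianGroup 0ℓ 0ℓ
  Hₖ isGroup = record { isAbelianGroup = isGroup }

  topRank-isRank : ∀ isGroup → HasRank (Hₖ isGroup) topRank
  topRank-isRank isGroup = hasRank (finiteₖ k) {Zₖ.Z k} (proj₂ (Zₖ.Z-basis k))
      (λ x → Zₖ.cycle⇒Z k (Dₖ.chain x) (Dₖ.isCycle x))
      λ w w∈ → Dₖ.cycle (Zₖ.X.fromCoords k w) (Zₖ.Z⇒cycle k w w∈) , Zₖ.X.coords-fromCoords k w
    where
    open EmbeddedGroup (Hₖ isGroup) (λ z → Dₖ.coefᴳ (Dₖ.chain z))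
      (λ x y → Coefficients.coef-++ Dₖ._≟ᴳ_ (Dₖ.chain x) (Dₖ.chain y)) (λ _ → refl)
      (λ x → Coefficients.coef-negate Dₖ._≟ᴳ_ (Dₖ.chain x))
      (λ {z} → ∼0⇒≈[] {z}) (λ {z} → Dₖ.≈⇒∼ z Dₖ.0ᶻ)

  -- Inequality enters only twice: in the passage from cycles of `Δ⟨ k ⟩` to those of `MC k`, and in
  -- the triangle inequality for the sum of the μ x y.
  topRank≤ : ∀ {μ} → IsMöbiusFunction finitePoset μ → Diagonal →
             topRank ℕ.≤ sum (map (λ (x , y) → ∣ μ x y ∣) (pairsOfSpan k))
  topRank≤ {μ} isMöbius diagonal = begin
    Zₖ.z k
      ≤⟨ zₖ≤zᴹ ⟩
    ZM.z k
      ≡⟨ ZM.euler-rank (TopPart.∂-∂ k) k (λ m m<k → diagonal k m (ℕ.<⇒≢ m<k)) ⟨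
    ∣ alternating (λ m → ⁺ length (chainsOver (pairsOfSpan k) m)) k ∣
      ≡⟨ cong ∣_∣ (alternating-chains isMöbius k) ⟩
    ∣ listSum (λ (x , y) → μ x y) (pairsOfSpan k) ∣
      ≤⟨ ∣listSum∣≤ (λ (x , y) → μ x y) (pairsOfSpan k) ⟩
    sum (map (λ (x , y) → ∣ μ x y ∣) (pairsOfSpan k)) ∎
    where open ℕ.≤-Reasoning

theorem1 : ∀ (n : ℕ) (P : GradedPoset n) → let open GradedPoset P in
    (μ : Carrier → Carrier → ℤ) → IsMöbiusFunction finitePoset μ →
    Diagonal →
    ∀ (k : ℕ) → k ℕ.≤ n →
    (∀ (i : ℕ) → i ℕ.< k → H i Δ⟨ k ⟩ ≅ H i Δ)
    × (∃[ ρ ] (HasRank (H k Δ⟨ k ⟩) ρ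
    × ρ ℕ.≤ sum (map (λ (x , y) → ∣ μ x y ∣) (pairsOfSpan k))))
theorem1 n P μ isMöbius diagonal k k≤n =
  RankFiltration.homology-iso P diagonal k k≤n ,
  topRank P k , topRank-isRank P k _ , topRank≤ P k isMöbius diagonal
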